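{- Let $n,k,r$ be positive integers with $n\ge 2r$. Then the algebra $\mathrm{MP}_{r,k}(n)$ is isomorphic to the algebra $\mathcal{A}_{r,k}(n)=\mathrm{End}_{\mathbb{C}S_n}(\mathcal{P}^r(V_{n,k}))$.
   Context: **The centralizer algebra.** $V_{n,k}=(\mathbb{C}^n)^k$, and $\mathcal{P}^r(V_{n,k})$ is the space of homogeneous polynomials of degree $r$ in the commuting variables $x_{ij}$, $1\le i\le n$, $1\le j\le k$, over $\mathbb{C}$. The symmetric group $S_n$ acts by permuting the first index: $\sigma\cdot x_{i_1j_1}\cdots x_{i_rj_r}=x_{\sigma(i_1)j_1}\cdots x_{\sigma(i_r)j_r}$. $\mathcal{A}_{r,k}(n)$ is the $\mathbb{C}$-algebra of all linear endomorphisms of $\mathcal{P}^r(V_{n,k})$ commuting with this action. **The multiset partition algebra.** Let $[k]=\{1,\dots,k\}$, $[\bar k]=\{\bar1,\dots,\bar k\}$, $[\bar{\bar k}]=\{\bar{\bar1},\dots,\bar{\bar k}\}$ be disjoint alphabets. A multiset partition of a multiset $S$ is a multiset of non-empty multisets (its blocks) whose multiset union is $S$. Its length $\ell(\pi)$ is the number of blocks counted with multiplicity; $m(\pi)!$ is the product, over the distinct blocks $T$ of $\pi$, of $m_T(\pi)!$, where $m_T(\pi)$ is the multiplicity of $T$ in $\pi$. $\Pi_{r,k}$ is the set of all multiset partitions of multisets consisting of $r$ elements from $[k]$ and $r$ elements from $[\bar k]$. $\Gamma_{r,k}$ is the set of all multiset partitions of multisets consisting of $r$ elements from each of $[k]$,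 $[\bar k]$, $[\bar{\bar k}]$. For a set $A$, $\nu|_A$ is obtained by restricting each block of $\nu$ to its elements in $A$ and discarding empty results. For $\gamma\in\Pi_{r,k}$, $\bar\gamma$ is obtained by adding one bar to every entry. For $\nu\in\Gamma_{r,k}$, $\nu|_{[k]\cup[\bar{\bar k}]}$ is regarded as an element of $\Pi_{r,k}$ by removing one bar from each doubly barred entry. For $\nu\in\Gamma_{r,k}$ and each distinct block $S$ of $\nu|_{[k]\cup[\bar{\bar k}]}$, let $\nu_S$ be the multiset of blocks $T$ of $\nu$ (with multiplicity) with $T|_{[k]\cup[\bar{\bar k}]}=S$. Let $\beta$ be the multiset of blocks of $\nu$ all of whose elements lie in $[\bar k]$. Define $$a_\nu=\prod_S\frac{\ell(\nu_S)!}{m(\nu_S)!},\qquad b_\nu(x)=\frac{(x-\ell(\nu|_{[k]\cup[\bar{\bar k}]}))_{\ell(\beta)}}{m(\beta)!},$$ with $S$ ranging over the distinct blocks of $\nu|_{[k]\cup[\bar{\bar k}]}$ and $(a)_s=a(a-1)\cdots(a-s+1)$. $\mathrm{MP}_{r,k}(n)$ is the $\mathbb{C}$-algebra with basis $\{X_\pi:\pi\in\Pi_{r,k}\}$ and product $$X_\pi\cdot X_\gamma=\sum_{\nu}a_\nu b_\nu(n)X_{\nu|_{[k]\cup[\bar{\bar k}]}},$$ summed over all $\nu\in\Gamma_{r,k}$ with $\nu|_{[k]\cup[\bar k]}=\pi$ and $\nu|_{[\bar k]\cup[\bar{\bar k}]}=\bar\gamma$ (i.e. the specialization at $x=n$ of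 the structure constants $a_\nu b_\nu(x)$, which are polynomials in $x$). -}

module Defs where

open import Algebra.Bundles using (CommutativeMonoid; CommutativeRing)
open import Algebra.Core using (Op₂)
import Algebra.Module.Bundles as ModuleBundles
import Algebra.Module.Morphism.Construct.Composition as Composition
import Algebra.Module.Morphism.Structures as ModuleMorphisms
import Algebra.Morphism.Definitions as MorphismDefinitions
import Algebra.Properties.CommutativeMonoid.Sum as CommutativeMonoidSum
import Algebra.Properties.CommutativeSemigroup as CommutativeSemigroupProperties
import Algebra.Properties.Ring as RingProperties
open import Algebra.Structures using (IsCommutativeRing)
open import Data.Bool.Base using (if_then_else_)
open import Data.Fin.Base using (Fin; zero; suc; punchIn)
open import Data.Fin.Patterns using (0F; 1F; 2F)
open import Data.Fin.Permutation using (Permutation′; _⟨$⟩ˡ_; flip)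
import Data.Fin.Properties as Finₚ
import Data.Integer.Base as ℤ
open import Data.List.Base as List
  using (List; []; _∷_; _++_; map; filter; foldr; length; upTo; concatMap; mapMaybe;
         cartesianProductWith; deduplicate)
import Data.List.Membership.DecPropositional as DecMembership
open import Data.List.Membership.Propositional using (_∈_)
import Data.List.Membership.Propositional.Properties as ∈ₚ
open import Data.List.Relation.Binary.Permutation.Propositional
  using (_↭_; ↭-refl; ↭-sym; ↭-trans; ↭-prep; ↭-isEquivalence)
open import Data.List.Relation.Binary.Permutation.Propositional.Properties
  using (∈-resp-↭; drop-mid; shift; ¬x∷xs↭[])
open import Data.List.Relation.Unary.All as All using (All; []; _∷_)
import Data.List.Relation.Unary.All.Properties as Allₚ
open import Data.List.Relation.Unary.Any as Any using (here; there)
import Data.List.Relation.Unary.Any.Properties as Anyₚ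
open import Data.List.Relation.Unary.Enumerates.Setoid using (IsEnumeration)
import Data.List.Relation.Unary.Enumerates.Setoid.Properties as Enumₚ
import Data.List.Relation.Unary.Unique.DecSetoid.Properties as Uniqueₚ
open import Data.List.Relation.Unary.Unique.Setoid using (Unique)
open import Data.Maybe.Base as Maybe using (Maybe)
import Data.Maybe.Relation.Unary.Any as MaybeAny
open import Data.Nat.Base as ℕ using (ℕ; zero; suc; NonZero; _⊔_; _!)
open import Data.Nat.ListAction using (sum; product)
open import Data.Nat.ListAction.Properties using (product≢0)
import Data.Nat.Properties as ℕₚ
open import Data.Product.Base using (_×_; _,_; ∃; proj₁; proj₂)
open import Data.Rational.Base as ℚ using (ℚ; 0ℚ; 1ℚ; ½)
import Data.Rational.Properties as ℚₚ
import Data.Rational.Solver as ℚ-Solver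
open import Data.Vec.Base as Vec using (Vec; []; _∷_; lookup; removeAt; tabulate)
import Data.Vec.Membership.Propositional.Properties as VecMemₚ
import Data.Vec.Properties as Vecₚ
open import Function.Base using (_∘_; _on_)
open import Function.Bundles using (Func)
open import Level using (0ℓ)
open import Relation.Binary.Bundles using (Setoid; DecSetoid)
import Relation.Binary.Construct.On as On
open import Relation.Binary.Definitions using (DecidableEquality)
open import Relation.Binary.PropositionalEquality as ≡
  using (_≡_; _≢_; refl; cong; cong₂; subst)
open import Relation.Binary.Structures using (IsEquivalence)
open import Relation.Nullary.Decidable
  using (Dec; yes; no; does; map′; _×-dec_; ¬?; dec⇒maybe)
open import Relation.Nullary.Negation using (contradiction)

-- Real numbers are Cauchy sequences of rationals, two sequences being
-- identified when their difference tends to 0.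

Eventually : (ℕ → Set) → Set
Eventually P = ∃ λ N → ∀ n → N ℕ.≤ n → P n

record ℝ : Set where
  no-eta-equality
  field
    approx : ℕ → ℚ
    cauchy : ∀ ε → 0ℚ ℚ.< ε →
             ∃ λ N → ∀ m n → N ℕ.≤ m → N ℕ.≤ n → ℚ.∣ approx m ℚ.- approx n ∣ ℚ.< ε

open ℝ public

infix 4 _≈ᴿ_
record _≈ᴿ_ (x y : ℝ) : Set where
  constructor mk≈ᴿ
  field
    close : ∀ ε → 0ℚ ℚ.< ε → Eventually λ n → ℚ.∣ approx x n ℚ.- approx y n ∣ ℚ.< ε

open _≈ᴿ_ public

private
  half : ℚ → ℚ
  half ε = ½ ℚ.* ε

  half+half : ∀ ε → half ε ℚ.+ half ε ≡ ε
  half+half ε = ≡.trans (≡.sym (ℚₚ.*-distribʳ-+ ε ½ ½)) (ℚₚ.*-identityˡ ε)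

  *-pos : ∀ {p q} → 0ℚ ℚ.< p → 0ℚ ℚ.< q → 0ℚ ℚ.< p ℚ.* q
  *-pos {p} {q} 0<p 0<q =
    ℚₚ.positive⁻¹ _ {{ℚₚ.pos*pos⇒pos p {{ℚ.positive 0<p}} q {{ℚ.positive 0<q}}}}

  half-pos : ∀ {ε} → 0ℚ ℚ.< ε → 0ℚ ℚ.< half ε
  half-pos = *-pos (ℚₚ.positive⁻¹ ½)

  ∣-∣-sum : ∀ p q {r s} → ℚ.∣ p ∣ ℚ.< r → ℚ.∣ q ∣ ℚ.< s → ℚ.∣ p ℚ.+ q ∣ ℚ.< r ℚ.+ s
  ∣-∣-sum p q p<r q<s = ℚₚ.≤-<-trans (ℚₚ.∣p+q∣≤∣p∣+∣q∣ p q) (ℚₚ.+-mono-< p<r q<s)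

  ∣-∣-halves : ∀ {ε} p q {t} → t ≡ p ℚ.+ q →
               ℚ.∣ p ∣ ℚ.< half ε → ℚ.∣ q ∣ ℚ.< half ε → ℚ.∣ t ∣ ℚ.< ε
  ∣-∣-halves {ε} p q refl p< q< = subst (_ ℚ.<_) (half+half ε) (∣-∣-sum p q p< q<)

  ∣-∣-swap : ∀ p q → ℚ.∣ p ℚ.- q ∣ ≡ ℚ.∣ q ℚ.- p ∣
  ∣-∣-swap p q = ≡.trans (≡.sym (ℚₚ.∣-p∣≡∣p∣ (p ℚ.- q)))
    (cong ℚ.∣_∣ (solve 2 (λ a b → :- (a :- b) := b :- a) refl p q))
    where open ℚ-Solver.+-*-Solver

  ∣-∣-zero : ∀ {p q ε} → p ≡ q → 0ℚ ℚ.< ε → ℚ.∣ p ℚ.- q ∣ ℚ.< ε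
  ∣-∣-zero {p} refl 0<ε = subst (λ t → ℚ.∣ t ∣ ℚ.< _) (≡.sym (ℚₚ.+-inverseʳ p)) 0<ε

  both : ∀ {P Q : ℕ → Set} → Eventually P → Eventually Q → Eventually λ n → P n × Q n
  both (M , p) (N , q) = M ⊔ N , λ n le →
    p n (ℕₚ.m⊔n≤o⇒m≤o M N le) , q n (ℕₚ.m⊔n≤o⇒n≤o M N le)

  mapᴱ : ∀ {P Q : ℕ → Set} → (∀ n → P n → Q n) → Eventually P → Eventually Q
  mapᴱ f (N , p) = N , λ n le → f n (p n le)

  +-split : ∀ a b c d → (a ℚ.+ b) ℚ.- (c ℚ.+ d) ≡ (a ℚ.- c) ℚ.+ (b ℚ.- d)
  +-split = solve 4 (λ a b c d → (a :+ b) :- (c :+ d) := (a :- c) :+ (b :- d)) refl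
    where open ℚ-Solver.+-*-Solver

  neg-split : ∀ a b → ℚ.- a ℚ.- ℚ.- b ≡ b ℚ.- a
  neg-split = solve 2 (λ a b → :- a :- :- b := b :- a) refl
    where open ℚ-Solver.+-*-Solver

  -- δ ε B is the tolerance below which B times an error stays below ε / 2.
  δ : ∀ ε {B} → 0ℚ ℚ.< B → ℚ
  δ ε {B} 0<B = half ε ℚ.* (ℚ.1/ B) {{ℚ.>-nonZero 0<B}}

  δ-pos : ∀ {ε B} → 0ℚ ℚ.< ε → (0<B : 0ℚ ℚ.< B) → 0ℚ ℚ.< δ ε 0<B
  δ-pos {ε} {B} 0<ε 0<B =
    *-pos (half-pos 0<ε) (ℚₚ.positive⁻¹ _ {{ℚₚ.1/pos⇒pos B {{ℚ.positive 0<B}}}})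

  δ-spec : ∀ ε {B} (0<B : 0ℚ ℚ.< B) → B ℚ.* δ ε 0<B ≡ half ε
  δ-spec ε {B} 0<B = ≡.trans
    (solve 3 (λ b h i → b :* (h :* i) := h :* (b :* i)) refl B (half ε) B⁻¹)
    (≡.trans (cong (half ε ℚ.*_) (ℚₚ.*-inverseʳ B {{ℚ.>-nonZero 0<B}})) (ℚₚ.*-identityʳ _))
    where
    open ℚ-Solver.+-*-Solver
    B⁻¹ = (ℚ.1/ B) {{ℚ.>-nonZero 0<B}}

  ∣-∣-prod : ∀ {A e} p q → ℚ.∣ p ∣ ℚ.< A → 0ℚ ℚ.< e → ℚ.∣ q ∣ ℚ.< e → ℚ.∣ p ℚ.* q ∣ ℚ.< A ℚ.* e
  ∣-∣-prod {A} {e} p q p<A 0<e q<e = subst (ℚ._< _) (≡.sym (ℚₚ.∣p*q∣≡∣p∣*∣q∣ p q))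
    (ℚₚ.≤-<-trans
      (ℚₚ.*-monoˡ-≤-nonNeg ℚ.∣ p ∣ {{ℚₚ.∣-∣-nonNeg p}} (ℚₚ.<⇒≤ q<e))
      (ℚₚ.*-monoˡ-<-pos e {{ℚ.positive 0<e}} p<A))

  *-close : ∀ {ε A B} → 0ℚ ℚ.< ε → (0<A : 0ℚ ℚ.< A) (0<B : 0ℚ ℚ.< B) → ∀ a a′ b b′ →
            ℚ.∣ a ∣ ℚ.< A → ℚ.∣ b′ ∣ ℚ.< B →
            ℚ.∣ a ℚ.- a′ ∣ ℚ.< δ ε 0<B → ℚ.∣ b ℚ.- b′ ∣ ℚ.< δ ε 0<A →
            ℚ.∣ a ℚ.* b ℚ.- a′ ℚ.* b′ ∣ ℚ.< ε
  *-close {ε} 0<ε 0<A 0<B a a′ b b′ a<A b′<B da db = ∣-∣-halves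
    (a ℚ.* (b ℚ.- b′)) (b′ ℚ.* (a ℚ.- a′))
    (solve 4 (λ a a′ b b′ → a :* b :- a′ :* b′ := a :* (b :- b′) :+ b′ :* (a :- a′)) refl a a′ b b′)
    (subst (_ ℚ.<_) (δ-spec ε 0<A) (∣-∣-prod a (b ℚ.- b′) a<A (δ-pos 0<ε 0<A) db))
    (subst (_ ℚ.<_) (δ-spec ε 0<B) (∣-∣-prod b′ (a ℚ.- a′) b′<B (δ-pos 0<ε 0<B) da))
    where open ℚ-Solver.+-*-Solver

  bounded : ∀ x → ∃ λ B → 0ℚ ℚ.< B × Eventually λ n → ℚ.∣ approx x n ∣ ℚ.< B
  bounded x = B , 0<B , N , λ n N≤n →
    subst (λ t → ℚ.∣ t ∣ ℚ.< B)
      (solve 2 (λ s t → (s :- t) :+ t := s) refl (approx x n) xN)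
      (ℚₚ.≤-<-trans (ℚₚ.∣p+q∣≤∣p∣+∣q∣ (approx x n ℚ.- xN) xN)
        (ℚₚ.+-monoˡ-< ℚ.∣ xN ∣ (h n N N≤n ℕₚ.≤-refl)))
    where
    open ℚ-Solver.+-*-Solver
    N  = proj₁ (cauchy x 1ℚ (ℚₚ.positive⁻¹ 1ℚ))
    h  = proj₂ (cauchy x 1ℚ (ℚₚ.positive⁻¹ 1ℚ))
    xN = approx x N
    B  = 1ℚ ℚ.+ ℚ.∣ xN ∣
    0<B : 0ℚ ℚ.< B
    0<B = ℚₚ.+-mono-<-≤ (ℚₚ.positive⁻¹ 1ℚ) (ℚₚ.0≤∣p∣ xN)

infixl 6 _+ᴿ_
infixl 7 _*ᴿ_
infix  8 -ᴿ_

ℚ→ℝ : ℚ → ℝ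
ℚ→ℝ q .approx _ = q
ℚ→ℝ q .cauchy ε 0<ε = 0 , λ _ _ _ _ → ∣-∣-zero {q} refl 0<ε

_+ᴿ_ : ℝ → ℝ → ℝ
(x +ᴿ y) .approx n = approx x n ℚ.+ approx y n
(x +ᴿ y) .cauchy ε 0<ε =
  let M , p = cauchy x (half ε) (half-pos 0<ε)
      N , q = cauchy y (half ε) (half-pos 0<ε)
  in M ⊔ N , λ m n M≤ N≤ → ∣-∣-halves _ _
       (+-split (approx x m) (approx y m) (approx x n) (approx y n))
       (p m n (ℕₚ.m⊔n≤o⇒m≤o M N M≤) (ℕₚ.m⊔n≤o⇒m≤o M N N≤))
       (q m n (ℕₚ.m⊔n≤o⇒n≤o M N M≤) (ℕₚ.m⊔n≤o⇒n≤o M N N≤))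

-ᴿ_ : ℝ → ℝ
(-ᴿ x) .approx n = ℚ.- approx x n
(-ᴿ x) .cauchy ε 0<ε =
  let N , p = cauchy x ε 0<ε
  in N , λ m n N≤m N≤n → subst (λ t → ℚ.∣ t ∣ ℚ.< ε)
       (≡.sym (neg-split (approx x m) (approx x n))) (p n m N≤n N≤m)

_*ᴿ_ : ℝ → ℝ → ℝ
(x *ᴿ y) .approx n = approx x n ℚ.* approx y n
(x *ᴿ y) .cauchy ε 0<ε =
  let A , 0<A , I , a = bounded x
      B , 0<B , J , b = bounded y
      M , p = cauchy x (δ ε 0<B) (δ-pos 0<ε 0<B)
      N , q = cauchy y (δ ε 0<A) (δ-pos 0<ε 0<A)
  in (I ⊔ J) ⊔ (M ⊔ N) , λ m n ≤m ≤n →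
       let IJ≤m = ℕₚ.m⊔n≤o⇒m≤o (I ⊔ J) (M ⊔ N) ≤m
           IJ≤n = ℕₚ.m⊔n≤o⇒m≤o (I ⊔ J) (M ⊔ N) ≤n
           MN≤m = ℕₚ.m⊔n≤o⇒n≤o (I ⊔ J) (M ⊔ N) ≤m
           MN≤n = ℕₚ.m⊔n≤o⇒n≤o (I ⊔ J) (M ⊔ N) ≤n
       in *-close 0<ε 0<A 0<B (approx x m) (approx x n) (approx y m) (approx y n)
            (a m (ℕₚ.m⊔n≤o⇒m≤o I J IJ≤m)) (b n (ℕₚ.m⊔n≤o⇒n≤o I J IJ≤n))
            (p m n (ℕₚ.m⊔n≤o⇒m≤o M N MN≤m) (ℕₚ.m⊔n≤o⇒m≤o M N MN≤n))
            (q m n (ℕₚ.m⊔n≤o⇒n≤o M N MN≤m) (ℕₚ.m⊔n≤o⇒n≤o M N MN≤n))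

pointwise : ∀ {x y} → (∀ n → approx x n ≡ approx y n) → x ≈ᴿ y
pointwise eq .close ε 0<ε = 0 , λ n _ → ∣-∣-zero (eq n) 0<ε

private
  ≈ᴿ-isEquivalence : IsEquivalence _≈ᴿ_
  ≈ᴿ-isEquivalence = record
    { refl  = pointwise λ _ → refl
    ; sym   = λ {x} {y} x≈y → mk≈ᴿ λ ε 0<ε → mapᴱ
        (λ n → subst (ℚ._< ε) (∣-∣-swap (approx x n) (approx y n))) (close x≈y ε 0<ε)
    ; trans = λ {x} {y} {z} x≈y y≈z → mk≈ᴿ λ ε 0<ε → mapᴱ
        (λ n (p , q) → ∣-∣-halves _ _
          (solve 3 (λ a b c → a :- c := (a :- b) :+ (b :- c)) refl
            (approx x n) (approx y n) (approx z n)) p q)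
        (both (close x≈y (half ε) (half-pos 0<ε)) (close y≈z (half ε) (half-pos 0<ε)))
    }
    where open ℚ-Solver.+-*-Solver

  +ᴿ-cong : ∀ {x y u v} → x ≈ᴿ y → u ≈ᴿ v → x +ᴿ u ≈ᴿ y +ᴿ v
  +ᴿ-cong {x} {y} {u} {v} x≈y u≈v .close ε 0<ε = mapᴱ
    (λ n (p , q) → ∣-∣-halves _ _
      (+-split (approx x n) (approx u n) (approx y n) (approx v n)) p q)
    (both (close x≈y (half ε) (half-pos 0<ε)) (close u≈v (half ε) (half-pos 0<ε)))

  -ᴿ-cong : ∀ {x y} → x ≈ᴿ y → -ᴿ x ≈ᴿ -ᴿ y
  -ᴿ-cong {x} {y} x≈y .close ε 0<ε = mapᴱ
    (λ n → subst (ℚ._< ε) (≡.trans (∣-∣-swap (approx x n) (approx y n))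
      (cong ℚ.∣_∣ (≡.sym (neg-split (approx x n) (approx y n))))))
    (close x≈y ε 0<ε)

  *ᴿ-cong : ∀ {x y u v} → x ≈ᴿ y → u ≈ᴿ v → x *ᴿ u ≈ᴿ y *ᴿ v
  *ᴿ-cong {x} {y} {u} {v} x≈y u≈v .close ε 0<ε =
    let A , 0<A , a = bounded x
        B , 0<B , b = bounded v
    in mapᴱ
      (λ n ((a , b) , (p , q)) → *-close 0<ε 0<A 0<B
        (approx x n) (approx y n) (approx u n) (approx v n) a b p q)
      (both (both a b) (both (close x≈y (δ ε 0<B) (δ-pos 0<ε 0<B))
                             (close u≈v (δ ε 0<A) (δ-pos 0<ε 0<A))))

  ℝ-isCommutativeRing : IsCommutativeRing _≈ᴿ_ _+ᴿ_ _*ᴿ_ -ᴿ_ (ℚ→ℝ 0ℚ) (ℚ→ℝ 1ℚ)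
  ℝ-isCommutativeRing = record
    { isRing = record
      { +-isAbelianGroup = record
        { isGroup = record
          { isMonoid = record
            { isSemigroup = record
              { isMagma = record
                { isEquivalence = ≈ᴿ-isEquivalence
                ; ∙-cong = +ᴿ-cong
                }
              ; assoc = λ x y z → pointwise λ n →
                  ℚₚ.+-assoc (approx x n) (approx y n) (approx z n)
              }
            ; identity = (λ x → pointwise λ n → ℚₚ.+-identityˡ (approx x n))
                       , (λ x → pointwise λ n → ℚₚ.+-identityʳ (approx x n))
            }
          ; inverse = (λ x → pointwise λ n → ℚₚ.+-inverseˡ (approx x n))
                    , (λ x → pointwise λ n → ℚₚ.+-inverseʳ (approx x n))
          ; ⁻¹-cong = -ᴿ-cong
          }
        ; comm = λ x y → pointwise λ n → ℚₚ.+-comm (approx x n) (approx y n)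
        }
      ; *-cong = *ᴿ-cong
      ; *-assoc = λ x y z → pointwise λ n →
          ℚₚ.*-assoc (approx x n) (approx y n) (approx z n)
      ; *-identity = (λ x → pointwise λ n → ℚₚ.*-identityˡ (approx x n))
                   , (λ x → pointwise λ n → ℚₚ.*-identityʳ (approx x n))
      ; distrib = (λ x y z → pointwise λ n →
                    ℚₚ.*-distribˡ-+ (approx x n) (approx y n) (approx z n))
                , (λ x y z → pointwise λ n →
                    ℚₚ.*-distribʳ-+ (approx x n) (approx y n) (approx z n))
      }
    ; *-comm = λ x y → pointwise λ n → ℚₚ.*-comm (approx x n) (approx y n)
    }

ℝ-commutativeRing : CommutativeRing 0ℓ 0ℓ
ℝ-commutativeRing = record { isCommutativeRing = ℝ-isCommutativeRing }

infix 5 _+i_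

record ℂ : Set where
  no-eta-equality
  constructor _+i_
  field
    re im : ℝ

open ℂ public

infix 4 _≈ᶜ_

record _≈ᶜ_ (z w : ℂ) : Set where
  constructor _,≈_
  field
    re≈ : re z ≈ᴿ re w
    im≈ : im z ≈ᴿ im w

infixl 6 _+ᶜ_
infixl 7 _*ᶜ_
infix  8 -ᶜ_

ℚ→ℂ : ℚ → ℂ
ℚ→ℂ q = ℚ→ℝ q +i ℚ→ℝ 0ℚ

_+ᶜ_ _*ᶜ_ : ℂ → ℂ → ℂ
z +ᶜ w = (re z +ᴿ re w) +i (im z +ᴿ im w)
z *ᶜ w = (re z *ᴿ re w +ᴿ -ᴿ (im z *ᴿ im w)) +i (re z *ᴿ im w +ᴿ im z *ᴿ re w)

-ᶜ_ : ℂ → ℂ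
-ᶜ z = (-ᴿ re z) +i (-ᴿ im z)

private
  ℂ-isCommutativeRing : IsCommutativeRing _≈ᶜ_ _+ᶜ_ _*ᶜ_ -ᶜ_ (ℚ→ℂ 0ℚ) (ℚ→ℂ 1ℚ)
  ℂ-isCommutativeRing = record
    { isRing = record
      { +-isAbelianGroup = record
        { isGroup = record
          { isMonoid = record
            { isSemigroup = record
              { isMagma = record
                { isEquivalence = record
                  { refl  = R.refl ,≈ R.refl
                  ; sym   = λ (p ,≈ q) → R.sym p ,≈ R.sym q
                  ; trans = λ (p ,≈ q) (p′ ,≈ q′) → R.trans p p′ ,≈ R.trans q q′
                  }
                ; ∙-cong = λ (p ,≈ q) (p′ ,≈ q′) → R.+-cong p p′ ,≈ R.+-cong q q′
                }
              ; assoc = λ x y z → R.+-assoc (re x) (re y) (re z) ,≈ R.+-assoc (im x) (im y) (im z)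
              }
            ; identity = (λ x → R.+-identityˡ (re x) ,≈ R.+-identityˡ (im x))
                       , (λ x → R.+-identityʳ (re x) ,≈ R.+-identityʳ (im x))
            }
          ; inverse = (λ x → R.-‿inverseˡ (re x) ,≈ R.-‿inverseˡ (im x))
                    , (λ x → R.-‿inverseʳ (re x) ,≈ R.-‿inverseʳ (im x))
          ; ⁻¹-cong = λ (p ,≈ q) → R.-‿cong p ,≈ R.-‿cong q
          }
        ; comm = λ x y → R.+-comm (re x) (re y) ,≈ R.+-comm (im x) (im y)
        }
      ; *-cong = λ (p ,≈ q) (p′ ,≈ q′) →
          R.+-cong (R.*-cong p p′) (R.-‿cong (R.*-cong q q′)) ,≈
          R.+-cong (R.*-cong p q′) (R.*-cong q p′)
      ; *-assoc = λ x y z → *-assoc-re x y z ,≈ *-assoc-im x y z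
      ; *-identity = *-identityˡ , *-identityʳ
      ; distrib = (λ x y z → distribˡ-re x y z ,≈ distribˡ-im x y z)
                , (λ x y z → distribʳ-re x y z ,≈ distribʳ-im x y z)
      }
    ; *-comm = λ x y →
        R.+-cong (R.*-comm (re x) (re y)) (R.-‿cong (R.*-comm (im x) (im y))) ,≈
        R.trans (R.+-comm (re x *ᴿ im y) (im x *ᴿ re y))
                (R.+-cong (R.*-comm (im x) (re y)) (R.*-comm (re x) (im y)))
    }
    where
    module R = CommutativeRing ℝ-commutativeRing
    open ℚ-Solver.+-*-Solver

    *-assoc-re : ∀ x y z → re ((x *ᶜ y) *ᶜ z) ≈ᴿ re (x *ᶜ (y *ᶜ z))
    *-assoc-re x y z = pointwise λ n →
      solve 6 (λ a b c d e f →
        (a :* c :+ :- (b :* d)) :* e :+ :- ((a :* d :+ b :* c) :* f) :=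
        a :* (c :* e :+ :- (d :* f)) :+ :- (b :* (c :* f :+ d :* e))) refl
        (approx (re x) n) (approx (im x) n) (approx (re y) n)
        (approx (im y) n) (approx (re z) n) (approx (im z) n)

    *-assoc-im : ∀ x y z → im ((x *ᶜ y) *ᶜ z) ≈ᴿ im (x *ᶜ (y *ᶜ z))
    *-assoc-im x y z = pointwise λ n →
      solve 6 (λ a b c d e f →
        (a :* c :+ :- (b :* d)) :* f :+ (a :* d :+ b :* c) :* e :=
        a :* (c :* f :+ d :* e) :+ b :* (c :* e :+ :- (d :* f))) refl
        (approx (re x) n) (approx (im x) n) (approx (re y) n)
        (approx (im y) n) (approx (re z) n) (approx (im z) n)

    *-identityˡ : ∀ x → ℚ→ℂ 1ℚ *ᶜ x ≈ᶜ x
    *-identityˡ x =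
      (pointwise λ n → solve 2 (λ a b → con 1ℚ :* a :+ :- (con 0ℚ :* b) := a) refl
        (approx (re x) n) (approx (im x) n)) ,≈
      (pointwise λ n → solve 2 (λ a b → con 1ℚ :* b :+ con 0ℚ :* a := b) refl
        (approx (re x) n) (approx (im x) n))

    *-identityʳ : ∀ x → x *ᶜ ℚ→ℂ 1ℚ ≈ᶜ x
    *-identityʳ x =
      (pointwise λ n → solve 2 (λ a b → a :* con 1ℚ :+ :- (b :* con 0ℚ) := a) refl
        (approx (re x) n) (approx (im x) n)) ,≈
      (pointwise λ n → solve 2 (λ a b → a :* con 0ℚ :+ b :* con 1ℚ := b) refl
        (approx (re x) n) (approx (im x) n))

    distribˡ-re : ∀ x y z → re (x *ᶜ (y +ᶜ z)) ≈ᴿ re (x *ᶜ y +ᶜ x *ᶜ z)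
    distribˡ-re x y z = pointwise λ n →
      solve 6 (λ a b c d e f →
        a :* (c :+ e) :+ :- (b :* (d :+ f)) :=
        (a :* c :+ :- (b :* d)) :+ (a :* e :+ :- (b :* f))) refl
        (approx (re x) n) (approx (im x) n) (approx (re y) n)
        (approx (im y) n) (approx (re z) n) (approx (im z) n)

    distribˡ-im : ∀ x y z → im (x *ᶜ (y +ᶜ z)) ≈ᴿ im (x *ᶜ y +ᶜ x *ᶜ z)
    distribˡ-im x y z = pointwise λ n →
      solve 6 (λ a b c d e f →
        a :* (d :+ f) :+ b :* (c :+ e) :=
        (a :* d :+ b :* c) :+ (a :* f :+ b :* e)) refl
        (approx (re x) n) (approx (im x) n) (approx (re y) n)
        (approx (im y) n) (approx (re z) n) (approx (im z) n)

    distribʳ-re : ∀ x y z → re ((y +ᶜ z) *ᶜ x) ≈ᴿ re (y *ᶜ x +ᶜ z *ᶜ x)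
    distribʳ-re x y z = pointwise λ n →
      solve 6 (λ a b c d e f →
        (c :+ e) :* a :+ :- ((d :+ f) :* b) :=
        (c :* a :+ :- (d :* b)) :+ (e :* a :+ :- (f :* b))) refl
        (approx (re x) n) (approx (im x) n) (approx (re y) n)
        (approx (im y) n) (approx (re z) n) (approx (im z) n)

    distribʳ-im : ∀ x y z → im ((y +ᶜ z) *ᶜ x) ≈ᴿ im (y *ᶜ x +ᶜ z *ᶜ x)
    distribʳ-im x y z = pointwise λ n →
      solve 6 (λ a b c d e f →
        (c :+ e) :* b :+ (d :+ f) :* a :=
        (c :* b :+ d :* a) :+ (e :* b :+ f :* a)) refl
        (approx (re x) n) (approx (im x) n) (approx (re y) n)
        (approx (im y) n) (approx (re z) n) (approx (im z) n)

ℂ-commutativeRing : CommutativeRing 0ℓ 0ℓ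
ℂ-commutativeRing = record { isCommutativeRing = ℂ-isCommutativeRing }

-- A finite multiset over d disjoint copies of the alphabet [k]: entry j of
-- row a is the multiplicity of the letter j carrying a bars.
Block : ℕ → ℕ → Set
Block d k = Vec (Vec ℕ k) d

_≟ᴮ_ : ∀ {d k} → DecidableEquality (Block d k)
_≟ᴮ_ = Vecₚ.≡-dec (Vecₚ.≡-dec ℕₚ._≟_)

∅ : ∀ {d k} → Block d k
∅ = Vec.replicate _ (Vec.replicate _ 0)

-- The number of letters with a bars occurring in a list of blocks.
letters : ∀ {d k} → Fin d → List (Block d k) → ℕ
letters a Ts = sum (map (λ T → Vec.sum (lookup T a)) Ts)

-- A multiset of blocks is a list of blocks up to _↭_.
record MultisetPartition (d r k : ℕ) : Set where
  constructor mkMP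
  field
    blocks    : List (Block d k)
    non-empty : All (_≢ ∅) blocks
    content   : ∀ a → letters a blocks ≡ r

open MultisetPartition public

infix 4 _≈ᴾ_ _≟ᴾ_

_≈ᴾ_ : ∀ {d r k} → MultisetPartition d r k → MultisetPartition d r k → Set
_≈ᴾ_ = _↭_ on blocks

↭-dec : ∀ {A : Set} → DecidableEquality A → (xs ys : List A) → Dec (xs ↭ ys)
↭-dec _≟_ []       []       = yes ↭-refl
↭-dec _≟_ []       (y ∷ ys) = no (¬x∷xs↭[] ∘ ↭-sym)
↭-dec _≟_ (x ∷ xs) ys       with DecMembership._∈?_ _≟_ x ys
... | no  x∉ys = no λ p → x∉ys (∈-resp-↭ p (here refl))
... | yes x∈ys with as , bs , refl ← ∈ₚ.∈-∃++ x∈ys =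
  map′ (λ p → ↭-trans (↭-prep x p) (↭-sym (shift x as bs))) (drop-mid [] as)
       (↭-dec _≟_ xs (as ++ bs))

_≟ᴾ_ : ∀ {d r k} (π γ : MultisetPartition d r k) → Dec (π ≈ᴾ γ)
π ≟ᴾ γ = ↭-dec _≟ᴮ_ (blocks π) (blocks γ)

partitionDecSetoid : (d r k : ℕ) → DecSetoid 0ℓ 0ℓ
partitionDecSetoid d r k = record
  { Carrier          = MultisetPartition d r k
  ; _≈_              = _≈ᴾ_
  ; isDecEquivalence = record
    { isEquivalence = On.isEquivalence blocks ↭-isEquivalence
    ; _≟_           = _≟ᴾ_
    }
  }

partitionSetoid : (d r k : ℕ) → Setoid 0ℓ 0ℓ
partitionSetoid d r k = DecSetoid.setoid (partitionDecSetoid d r k)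

tuples : ∀ {A : Set} → List A → (n : ℕ) → List (Vec A n)
tuples xs zero    = [] ∷ []
tuples xs (suc n) = cartesianProductWith _∷_ xs (tuples xs n)

-- The blocks of a partition have letter multiplicities at most r, and there are
-- at most d * r of them.
candidates : (d r k : ℕ) → List (List (Block d k))
candidates d r k = concatMap
  (λ l → map Vec.toList (tuples (tuples (tuples (upTo (suc r)) k) d) l))
  (upTo (suc (d ℕ.* r)))

asPartition : ∀ {d r k} → List (Block d k) → Maybe (MultisetPartition d r k)
asPartition {r = r} Ts = Maybe.map (λ (p , q) → mkMP Ts p q)
  (dec⇒maybe (All.all? (λ T → ¬? (T ≟ᴮ ∅)) Ts ×-dec
              Finₚ.all? (λ a → letters a Ts ℕₚ.≟ r)))

-- Each class of _≈ᴾ_ is represented exactly once: see partitions-unique and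
-- partitions-complete.
partitions : (d r k : ℕ) → List (MultisetPartition d r k)
partitions d r k = deduplicate _≟ᴾ_ (mapMaybe asPartition (candidates d r k))

partitions-unique : ∀ d r k → Unique (partitionSetoid d r k) (partitions d r k)
partitions-unique d r k = Uniqueₚ.deduplicate-! (partitionDecSetoid d r k) _

private
  tuples-complete : ∀ {A : Set} {xs : List A} {n} (v : Vec A n) →
                    (∀ i → lookup v i ∈ xs) → v ∈ tuples xs n
  tuples-complete []      h = here refl
  tuples-complete (x ∷ v) h =
    ∈ₚ.∈-cartesianProductWith⁺ _∷_ (h zero) (tuples-complete v (h ∘ suc))

  lookup≤sum : ∀ {n} (v : Vec ℕ n) i → lookup v i ℕ.≤ Vec.sum v
  lookup≤sum (x ∷ v) zero    = ℕₚ.m≤m+n x (Vec.sum v)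
  lookup≤sum (x ∷ v) (suc i) = ℕₚ.≤-trans (lookup≤sum v i) (ℕₚ.m≤n+m (Vec.sum v) x)

  ∈⇒≤letters : ∀ {d k} a {T : Block d k} {Ts} → T ∈ Ts → Vec.sum (lookup T a) ℕ.≤ letters a Ts
  ∈⇒≤letters a {Ts = _ ∷ _} (here refl) = ℕₚ.m≤m+n _ _
  ∈⇒≤letters a {Ts = _ ∷ _} (there T∈)  = ℕₚ.≤-trans (∈⇒≤letters a T∈) (ℕₚ.m≤n+m _ _)

  rowSums : ∀ {d k} → Block d k → ℕ
  rowSums T = Vec.sum (Vec.map Vec.sum T)

  sum≡0 : ∀ {k} (v : Vec ℕ k) → Vec.sum v ≡ 0 → v ≡ Vec.replicate k 0
  sum≡0 []         _  = refl
  sum≡0 (zero ∷ v) eq = cong (0 ∷_) (sum≡0 v eq)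

  rowSums≡0 : ∀ {d k} (T : Block d k) → rowSums T ≡ 0 → T ≡ ∅
  rowSums≡0 []      _  = refl
  rowSums≡0 (v ∷ T) eq = cong₂ _∷_
    (sum≡0 v (ℕₚ.m+n≡0⇒m≡0 (Vec.sum v) eq)) (rowSums≡0 T (ℕₚ.m+n≡0⇒n≡0 (Vec.sum v) eq))

  length≤rowSums : ∀ {d k} {Ts : List (Block d k)} → All (_≢ ∅) Ts →
                   length Ts ℕ.≤ sum (map rowSums Ts)
  length≤rowSums []                 = ℕ.z≤n
  length≤rowSums {Ts = T ∷ _} (p ∷ ps) =
    ℕₚ.+-mono-≤ (ℕₚ.n≢0⇒n>0 (p ∘ rowSums≡0 T)) (length≤rowSums ps)

  -- Splitting off the first row of every block.
  head-tail : ∀ {d k} (Ts : List (Block (suc d) k)) →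
              sum (map rowSums Ts) ≡ letters zero Ts ℕ.+ sum (map rowSums (map Vec.tail Ts))
  head-tail []             = refl
  head-tail ((v ∷ T) ∷ Ts) rewrite head-tail Ts =
    ℕ+-interchange (Vec.sum v) (rowSums T) (letters zero Ts) _
    where ℕ+-interchange = CommutativeSemigroupProperties.interchange ℕₚ.+-commutativeSemigroup

  letters-tail : ∀ {d k} a (Ts : List (Block (suc d) k)) →
                 letters a (map Vec.tail Ts) ≡ letters (suc a) Ts
  letters-tail a []             = refl
  letters-tail a ((_ ∷ T) ∷ Ts) = cong (Vec.sum (lookup T a) ℕ.+_) (letters-tail a Ts)

  rowSums≡d*r : ∀ {d k r} (Ts : List (Block d k)) → (∀ a → letters a Ts ≡ r) →
                sum (map rowSums Ts) ≡ d ℕ.* r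
  rowSums≡d*r {zero}  []        _ = refl
  rowSums≡d*r {zero} {r = r} ([] ∷ Ts) h = rowSums≡d*r {r = r} Ts λ ()
  rowSums≡d*r {suc d} Ts        h = ≡.trans (head-tail Ts) (cong₂ ℕ._+_ (h zero)
    (rowSums≡d*r (map Vec.tail Ts) λ a → ≡.trans (letters-tail a Ts) (h (suc a))))

  candidates-complete : ∀ {d r k} (π : MultisetPartition d r k) → blocks π ∈ candidates d r k
  candidates-complete {d} {r} {k} (mkMP Ts p c) = ∈ₚ.∈-concatMap⁺ _ (Any.map
    (λ {l} l≡ → subst (λ l → Ts ∈ map Vec.toList (tuples _ l)) l≡
      (subst (_∈ map Vec.toList (tuples _ (length Ts))) (Vecₚ.toList∘fromList Ts)
        (∈ₚ.∈-map⁺ Vec.toList (tuples-complete (Vec.fromList Ts) λ i →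
          tuples-complete _ λ a → tuples-complete _ λ j →
          ∈ₚ.∈-upTo⁺ (ℕ.s≤s (ℕₚ.≤-trans (lookup≤sum (lookup (lookup (Vec.fromList Ts) i) a) j)
            (subst (_ ℕ.≤_) (c a) (∈⇒≤letters a
              (subst (lookup (Vec.fromList Ts) i ∈_) (Vecₚ.toList∘fromList Ts)
                (VecMemₚ.∈-toList⁺ (VecMemₚ.∈-lookup i (Vec.fromList Ts))))))))))))
    (∈ₚ.∈-upTo⁺ (ℕ.s≤s (subst (length Ts ℕ.≤_) (rowSums≡d*r Ts c) (length≤rowSums p)))))

  asPartition-complete : ∀ {d r k} (π : MultisetPartition d r k) →
                         MaybeAny.Any (π ≈ᴾ_) (asPartition (blocks π))
  asPartition-complete {r = r} (mkMP Ts p c)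
    with All.all? (λ T → ¬? (T ≟ᴮ ∅)) Ts | Finₚ.all? (λ a → letters a Ts ℕₚ.≟ r)
  ... | yes _ | yes _ = MaybeAny.just ↭-refl
  ... | no ¬p | _     = contradiction p ¬p
  ... | yes _ | no ¬c = contradiction c ¬c

partitions-complete : ∀ d r k → IsEnumeration (partitionSetoid d r k) (partitions d r k)
partitions-complete d r k = Enumₚ.deduplicate⁺ (partitionDecSetoid d r k) λ π →
  Anyₚ.mapMaybe⁺ asPartition (candidates d r k)
    (Anyₚ.map⁺ (Any.map (λ { refl → asPartition-complete π }) (candidates-complete π)))

private
  lookup-removeAt : ∀ {A : Set} {n} (v : Vec A (suc n)) i j →
                    lookup (removeAt v i) j ≡ lookup v (punchIn i j)
  lookup-removeAt (x ∷ v)     zero    j       = refl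
  lookup-removeAt (x ∷ y ∷ v) (suc i) zero    = refl
  lookup-removeAt (x ∷ y ∷ v) (suc i) (suc j) = lookup-removeAt (y ∷ v) i j

  sum-replicate-0 : ∀ k → Vec.sum (Vec.replicate k 0) ≡ 0
  sum-replicate-0 zero    = refl
  sum-replicate-0 (suc k) = sum-replicate-0 k

  sum-∅ : ∀ {d} k (a : Fin d) → Vec.sum (lookup (∅ {d} {k}) a) ≡ 0
  sum-∅ k a = ≡.trans (cong Vec.sum (Vecₚ.lookup-replicate a _)) (sum-replicate-0 k)

-- ν with the letters carrying i bars deleted.  The remaining alphabets are
-- renumbered in order, so the letters with more than i bars lose one bar.
restrictBlocks : ∀ {d k} → Fin (suc d) → List (Block (suc d) k) → List (Block d k)
restrictBlocks i Ts = filter (λ T → ¬? (T ≟ᴮ ∅)) (map (λ T → removeAt T i) Ts)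

private
  letters-restrict : ∀ {d k} i (a : Fin d) (Ts : List (Block (suc d) k)) →
                     letters a (restrictBlocks i Ts) ≡ letters (punchIn i a) Ts
  letters-restrict i a []       = refl
  letters-restrict {k = k} i a (T ∷ Ts) with removeAt T i ≟ᴮ ∅
  ... | no  _ = cong₂ ℕ._+_ (cong Vec.sum (lookup-removeAt T i a)) (letters-restrict i a Ts)
  ... | yes e = ≡.trans (letters-restrict i a Ts) (cong (ℕ._+ letters (punchIn i a) Ts)
    (≡.trans (≡.sym (sum-∅ k a)) (≡.trans (cong (λ S → Vec.sum (lookup S a)) (≡.sym e))
      (cong Vec.sum (lookup-removeAt T i a)))))

restrict : ∀ {d r k} → Fin (suc d) → MultisetPartition (suc d) r k → MultisetPartition d r k
restrict i ν .blocks    = restrictBlocks i (blocks ν)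
restrict i ν .non-empty = Allₚ.all-filter (λ T → ¬? (T ≟ᴮ ∅)) (map (λ T → removeAt T i) (blocks ν))
restrict i ν .content a = ≡.trans (letters-restrict i a (blocks ν)) (content ν (punchIn i a))

-- With [k], [k̄], [k̄̄] numbered 0, 1, 2:  the restrictions to [k] ∪ [k̄], to
-- [k̄] ∪ [k̄̄] (one bar removed from every entry) and to [k] ∪ [k̄̄] (one bar
-- removed from the doubly barred entries).
_∣₀₁ _∣₁₂ _∣₀₂ : ∀ {r k} → MultisetPartition 3 r k → MultisetPartition 2 r k
_∣₀₁ = restrict 2F
_∣₁₂ = restrict 0F
_∣₀₂ = restrict 1F

multiplicity : ∀ {d k} → Block d k → List (Block d k) → ℕ
multiplicity T Ts = length (filter (_≟ᴮ T) Ts)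

-- m(Ts)! for the multiset of blocks Ts.
m! : ∀ {d k} → List (Block d k) → ℕ
m! Ts = product (map (λ T → multiplicity T Ts !) (deduplicate _≟ᴮ_ Ts))

m!-nonZero : ∀ {d k} (Ts : List (Block d k)) → NonZero (m! Ts)
m!-nonZero Ts = product≢0
  (Allₚ.map⁺ (All.universal (λ T → multiplicity T Ts ℕₚ.!≢0) (deduplicate _≟ᴮ_ Ts)))

infixl 7 _/m!_
_/m!_ : ∀ {d k} → ℕ → List (Block d k) → ℚ
p /m! Ts = (ℤ.+ p ℚ./ m! Ts) {{m!-nonZero Ts}}

-- x (x - 1) ⋯ (x - s + 1)
falling : ℚ → ℕ → ℚ
falling x zero    = 1ℚ
falling x (suc s) = x ℚ.* falling (x ℚ.- 1ℚ) s

fromℕ : ℕ → ℚ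
fromℕ m = ℤ.+ m ℚ./ 1

-- The blocks T of ν whose restriction to [k] ∪ [k̄̄] is S.  For S = ∅ these
-- are the blocks all of whose elements lie in [k̄].
fiber : ∀ {r k} → MultisetPartition 3 r k → Block 2 k → List (Block 3 k)
fiber ν S = filter (λ T → removeAt T 1F ≟ᴮ S) (blocks ν)

a⟨_⟩ : ∀ {r k} → MultisetPartition 3 r k → ℚ
a⟨ ν ⟩ = foldr ℚ._*_ 1ℚ (map (λ S → length (fiber ν S) ! /m! fiber ν S)
                           (deduplicate _≟ᴮ_ (blocks (ν ∣₀₂))))

b⟨_⟩ : ∀ {r k} → MultisetPartition 3 r k → ℚ → ℚ
b⟨ ν ⟩ x = falling (x ℚ.- fromℕ (length (blocks (ν ∣₀₂)))) (length (fiber ν ∅))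
           ℚ.* (1 /m! fiber ν ∅)

private
  module Σℕ = CommutativeMonoidSum ℕₚ.+-0-commutativeMonoid

degree : ∀ {n k} → Vec (Vec ℕ k) n → ℕ
degree e = Σℕ.sum λ i → Vec.sum (lookup e i)

record Monomial (n k r : ℕ) : Set where
  constructor mkMonomial
  field
    exponents : Vec (Vec ℕ k) n
    degree≡r  : degree exponents ≡ r

open Monomial public

-- Row i of exponents becomes row σ i.
permuteRows : ∀ {n k} → Permutation′ n → Vec (Vec ℕ k) n → Vec (Vec ℕ k) n
permuteRows σ e = tabulate λ i → lookup e (σ ⟨$⟩ˡ i)

private
  degree-permuteRows : ∀ {n k} (σ : Permutation′ n) (e : Vec (Vec ℕ k) n) →
                       degree (permuteRows σ e) ≡ degree e
  degree-permuteRows σ e = ≡.trans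
    (Σℕ.sum-cong-≗ λ i → cong Vec.sum (Vecₚ.lookup∘tabulate (λ i → lookup e (σ ⟨$⟩ˡ i)) i))
    (≡.sym (Σℕ.sum-permute (λ i → Vec.sum (lookup e i)) (flip σ)))

infixr 7 _·_
_·_ : ∀ {n k r} → Permutation′ n → Monomial n k r → Monomial n k r
σ · m = mkMonomial (permuteRows σ (exponents m))
                   (≡.trans (degree-permuteRows σ (exponents m)) (degree≡r m))

-- Everything below makes sense over any commutative ring 𝕂 receiving the
-- rationals; it is opened at 𝕂 = ℂ at the end.
module Over (𝕂 : CommutativeRing 0ℓ 0ℓ) (fromℚ : ℚ → CommutativeRing.Carrier 𝕂) where

  private
    module K = CommutativeRing 𝕂

  open ModuleBundles using (LeftModule)
  open ModuleMorphisms using (IsLeftModuleHomomorphism; IsLeftModuleIsomorphism)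

  -- A multiplication on a module.  No axiom is imposed: the isomorphism below
  -- transports those satisfied on one side, and the unit, to the other side.
  record Algebra : Set₁ where
    field
      leftModule : LeftModule K.ring 0ℓ 0ℓ
    open LeftModule leftModule public
    infixl 7 _*_
    field
      _*_ : Op₂ Carrierᴹ

  infix 4 _≅_

  record _≅_ (A B : Algebra) : Set where
    private
      module A = Algebra A
      module B = Algebra B
    open MorphismDefinitions A.Carrierᴹ B.Carrierᴹ B._≈ᴹ_ using (Homomorphic₂)
    field
      to       : A.Carrierᴹ → B.Carrierᴹ
      isLinear : IsLeftModuleIsomorphism A.rawLeftModule B.rawLeftModule to
      *-homo   : Homomorphic₂ to A._*_ B._*_

  -- The module of 𝕂-valued functions on S.  If S is finite up to its equality,
  -- this is the free module with basis S, the function f being Σ f(s) s.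
  functions : Setoid 0ℓ 0ℓ → LeftModule K.ring 0ℓ 0ℓ
  functions S = record
    { Carrierᴹ = Func S K.setoid
    ; _≈ᴹ_     = λ f g → ∀ s → to f s K.≈ to g s
    ; _+ᴹ_     = λ f g → record { to = λ s → to f s K.+ to g s
                                ; cong = λ e → K.+-cong (Func.cong f e) (Func.cong g e) }
    ; _*ₗ_     = λ c f → record { to = λ s → c K.* to f s
                                ; cong = λ e → K.*-congˡ (Func.cong f e) }
    ; 0ᴹ       = record { to = λ _ → K.0# ; cong = λ _ → K.refl }
    ; -ᴹ_      = λ f → record { to = λ s → K.- to f s
                              ; cong = λ e → K.-‿cong (Func.cong f e) }
    ; isLeftModule = record
      { isLeftSemimodule = record
        { +ᴹ-isCommutativeMonoid = record
          { isMonoid = record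
            { isSemigroup = record
              { isMagma = record
                { isEquivalence = record
                  { refl  = λ _ → K.refl
                  ; sym   = λ p s → K.sym (p s)
                  ; trans = λ p q s → K.trans (p s) (q s)
                  }
                ; ∙-cong = λ p q s → K.+-cong (p s) (q s)
                }
              ; assoc = λ _ _ _ _ → K.+-assoc _ _ _
              }
            ; identity = (λ _ _ → K.+-identityˡ _) , (λ _ _ → K.+-identityʳ _)
            }
          ; comm = λ _ _ _ → K.+-comm _ _
          }
        ; isPreleftSemimodule = record
          { *ₗ-cong      = λ p q s → K.*-cong p (q s)
          ; *ₗ-zeroˡ     = λ _ _ → K.zeroˡ _
          ; *ₗ-distribʳ  = λ _ _ _ _ → K.distribʳ _ _ _
          ; *ₗ-identityˡ = λ _ _ → K.*-identityˡ _
          ; *ₗ-assoc     = λ _ _ _ _ → K.*-assoc _ _ _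
          ; *ₗ-zeroʳ     = λ _ _ → K.zeroʳ _
          ; *ₗ-distribˡ  = λ _ _ _ _ → K.distribˡ _ _ _
          }
        }
      ; -ᴹ‿cong    = λ p s → K.-‿cong (p s)
      ; -ᴹ‿inverse = (λ _ _ → K.-‿inverseˡ _) , (λ _ _ → K.-‿inverseʳ _)
      }
    }
    where open Func using (to)

  module _ (n k r : ℕ) where

    -- Homogeneous polynomials of degree r, given by their coefficients.
    𝒫 : LeftModule K.ring 0ℓ 0ℓ
    𝒫 = functions (≡.setoid (Monomial n k r))

    private
      module P = LeftModule 𝒫

    -- The linear extension of σ · m: the coefficient of m in σ ▷ p is the
    -- coefficient of σ⁻¹ · m in p.
    infixr 7 _▷_
    _▷_ : Permutation′ n → P.Carrierᴹ → P.Carrierᴹ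
    σ ▷ p = record { to = λ m → Func.to p (flip σ · m) ; cong = λ { refl → K.refl } }

    record Endomorphism : Set where
      field
        apply       : P.Carrierᴹ → P.Carrierᴹ
        isLinear    : IsLeftModuleHomomorphism P.rawLeftModule P.rawLeftModule apply
        equivariant : ∀ σ p → apply (σ ▷ p) P.≈ᴹ σ ▷ apply p

    private
      open Endomorphism
      module Lin (f : Endomorphism) = IsLeftModuleHomomorphism (isLinear f)
      open RingProperties K.ring using (-0#≈0#; -‿distribʳ-*; -‿+-comm)
      module +Lemmas = CommutativeSemigroupProperties
        (CommutativeMonoid.commutativeSemigroup K.+-commutativeMonoid)
      module *Lemmas = CommutativeSemigroupProperties K.*-commutativeSemigroup

      linear : ∀ (f : P.Carrierᴹ → P.Carrierᴹ) → (∀ {p q} → p P.≈ᴹ q → f p P.≈ᴹ f q) →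
               (∀ p q → f (p P.+ᴹ q) P.≈ᴹ f p P.+ᴹ f q) → f P.0ᴹ P.≈ᴹ P.0ᴹ →
               (∀ p → f (P.-ᴹ p) P.≈ᴹ P.-ᴹ f p) → (∀ c p → f (c P.*ₗ p) P.≈ᴹ c P.*ₗ f p) →
               IsLeftModuleHomomorphism P.rawLeftModule P.rawLeftModule f
      linear f c a z i s = record
        { +ᴹ-isGroupHomomorphism = record
          { isMonoidHomomorphism = record
            { isMagmaHomomorphism = record
              { isRelHomomorphism = record { cong = c }
              ; homo = a
              }
            ; ε-homo = z
            }
          ; ⁻¹-homo = i
          }
        ; *ₗ-homo = s
        }

    infixl 6 _+ᴱ_
    infixl 7 _∘ᴱ_ _*ᴱ_
    infix  8 -ᴱ_

    _+ᴱ_ _∘ᴱ_ : Endomorphism → Endomorphism → Endomorphism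

    (f +ᴱ g) .apply p = apply f p P.+ᴹ apply g p
    (f +ᴱ g) .isLinear = linear _
      (λ e m → K.+-cong (Lin.⟦⟧-cong f e m) (Lin.⟦⟧-cong g e m))
      (λ p q m → K.trans (K.+-cong (Lin.+ᴹ-homo f p q m) (Lin.+ᴹ-homo g p q m))
                         (+Lemmas.interchange _ _ _ _))
      (λ m → K.trans (K.+-cong (Lin.0ᴹ-homo f m) (Lin.0ᴹ-homo g m)) (K.+-identityˡ _))
      (λ p m → K.trans (K.+-cong (Lin.-ᴹ-homo f p m) (Lin.-ᴹ-homo g p m)) (-‿+-comm _ _))
      (λ c p m → K.trans (K.+-cong (Lin.*ₗ-homo f c p m) (Lin.*ₗ-homo g c p m))
                         (K.sym (K.distribˡ _ _ _)))
    (f +ᴱ g) .equivariant σ p m = K.+-cong (equivariant f σ p m) (equivariant g σ p m)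

    (f ∘ᴱ g) .apply p = apply f (apply g p)
    (f ∘ᴱ g) .isLinear =
      Composition.isLeftModuleHomomorphism
        (λ p q m → K.trans (p m) (q m)) (isLinear g) (isLinear f)
    (f ∘ᴱ g) .equivariant σ p m =
      K.trans (Lin.⟦⟧-cong f (equivariant g σ p) m) (equivariant f σ (apply g p) m)

    _*ᴱ_ : K.Carrier → Endomorphism → Endomorphism
    (c *ᴱ f) .apply p = c P.*ₗ apply f p
    (c *ᴱ f) .isLinear = linear _
      (λ e m → K.*-congˡ (Lin.⟦⟧-cong f e m))
      (λ p q m → K.trans (K.*-congˡ (Lin.+ᴹ-homo f p q m)) (K.distribˡ _ _ _))
      (λ m → K.trans (K.*-congˡ (Lin.0ᴹ-homo f m)) (K.zeroʳ _))
      (λ p m → K.trans (K.*-congˡ (Lin.-ᴹ-homo f p m)) (K.sym (-‿distribʳ-* _ _)))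
      (λ d p m → K.trans (K.*-congˡ (Lin.*ₗ-homo f d p m)) (*Lemmas.x∙yz≈y∙xz _ _ _))
    (c *ᴱ f) .equivariant σ p m = K.*-congˡ (equivariant f σ p m)

    0ᴱ : Endomorphism
    0ᴱ .apply _ = P.0ᴹ
    0ᴱ .isLinear = linear _ (λ _ _ → K.refl) (λ _ _ _ → K.sym (K.+-identityˡ _))
      (λ _ → K.refl) (λ _ _ → K.sym -0#≈0#) (λ _ _ _ → K.sym (K.zeroʳ _))
    0ᴱ .equivariant _ _ _ = K.refl

    -ᴱ_ : Endomorphism → Endomorphism
    (-ᴱ f) .apply p = P.-ᴹ apply f p
    (-ᴱ f) .isLinear = linear _
      (λ e m → K.-‿cong (Lin.⟦⟧-cong f e m))
      (λ p q m → K.trans (K.-‿cong (Lin.+ᴹ-homo f p q m)) (K.sym (-‿+-comm _ _)))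
      (λ m → K.trans (K.-‿cong (Lin.0ᴹ-homo f m)) -0#≈0#)
      (λ p m → K.-‿cong (Lin.-ᴹ-homo f p m))
      (λ c p m → K.trans (K.-‿cong (Lin.*ₗ-homo f c p m)) (-‿distribʳ-* _ _))
    (-ᴱ f) .equivariant σ p m = K.-‿cong (equivariant f σ p m)

    𝒜 : Algebra
    𝒜 = record
      { leftModule = record
        { Carrierᴹ = Endomorphism
        ; _≈ᴹ_     = λ f g → ∀ p → apply f p P.≈ᴹ apply g p
        ; _+ᴹ_     = _+ᴱ_
        ; _*ₗ_     = _*ᴱ_
        ; 0ᴹ       = 0ᴱ
        ; -ᴹ_      = -ᴱ_
        ; isLeftModule = record
          { isLeftSemimodule = record
            { +ᴹ-isCommutativeMonoid = record
              { isMonoid = record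
                { isSemigroup = record
                  { isMagma = record
                    { isEquivalence = record
                      { refl  = λ _ _ → K.refl
                      ; sym   = λ e p m → K.sym (e p m)
                      ; trans = λ e e′ p m → K.trans (e p m) (e′ p m)
                      }
                    ; ∙-cong = λ e e′ p m → K.+-cong (e p m) (e′ p m)
                    }
                  ; assoc = λ _ _ _ _ _ → K.+-assoc _ _ _
                  }
                ; identity = (λ _ _ _ → K.+-identityˡ _) , (λ _ _ _ → K.+-identityʳ _)
                }
              ; comm = λ _ _ _ _ → K.+-comm _ _
              }
            ; isPreleftSemimodule = record
              { *ₗ-cong      = λ c e p m → K.*-cong c (e p m)
              ; *ₗ-zeroˡ     = λ _ _ _ → K.zeroˡ _
              ; *ₗ-distribʳ  = λ _ _ _ _ _ → K.distribʳ _ _ _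
              ; *ₗ-identityˡ = λ _ _ _ → K.*-identityˡ _
              ; *ₗ-assoc     = λ _ _ _ _ _ → K.*-assoc _ _ _
              ; *ₗ-zeroʳ     = λ _ _ _ → K.zeroʳ _
              ; *ₗ-distribˡ  = λ _ _ _ _ _ → K.distribˡ _ _ _
              }
            }
          ; -ᴹ‿cong    = λ e p m → K.-‿cong (e p m)
          ; -ᴹ‿inverse = (λ _ _ _ → K.-‿inverseˡ _) , (λ _ _ _ → K.-‿inverseʳ _)
          }
        }
      ; _*_ = _∘ᴱ_
      }

  module _ (r k : ℕ) where

    private
      Π : Set
      Π = MultisetPartition 2 r k

    MP-module : LeftModule K.ring 0ℓ 0ℓ
    MP-module = functions (partitionSetoid 2 r k)

    open LeftModule MP-module using (Carrierᴹ; _+ᴹ_; _*ₗ_; 0ᴹ)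

    ∑ : ∀ {A : Set} → List A → (A → Carrierᴹ) → Carrierᴹ
    ∑ xs f = foldr _+ᴹ_ 0ᴹ (map f xs)

    X : Π → Carrierᴹ
    X π = record
      { to   = λ ρ → if does (π ≟ᴾ ρ) then K.1# else K.0#
      ; cong = λ {ρ} {ρ′} → indicator-cong ρ ρ′
      }
      where
      indicator-cong : ∀ ρ ρ′ → ρ ≈ᴾ ρ′ → (if does (π ≟ᴾ ρ) then K.1# else K.0#) K.≈
                                          (if does (π ≟ᴾ ρ′) then K.1# else K.0#)
      indicator-cong ρ ρ′ e with π ≟ᴾ ρ | π ≟ᴾ ρ′
      ... | yes _ | yes _ = K.refl
      ... | no  _ | no  _ = K.refl
      ... | yes p | no ¬q = contradiction (↭-trans p e) ¬q
      ... | no ¬p | yes q = contradiction (↭-trans q (↭-sym e)) ¬p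

    module _ (n : ℕ) where

      -- X π · X γ
      X-product : Π → Π → Carrierᴹ
      X-product π γ =
        ∑ (filter (λ ν → (ν ∣₀₁ ≟ᴾ π) ×-dec (ν ∣₁₂ ≟ᴾ γ)) (partitions 3 r k))
          λ ν → fromℚ (a⟨ ν ⟩ ℚ.* b⟨ ν ⟩ (fromℕ n)) *ₗ X (ν ∣₀₂)

      MP : Algebra
      MP = record
        { leftModule = MP-module
        ; _*_        = λ u v →
            ∑ (partitions 2 r k) λ π → ∑ (partitions 2 r k) λ γ →
              (Func.to u π K.* Func.to v γ) *ₗ X-product π γ
        }

open Over ℂ-commutativeRing ℚ→ℂ public

{-# OPTIONS --safe #-}
-- An endomorphism commuting with S_n is a matrix F(e, m), indexed by pairs of
-- monomials and constant on S_n-orbits.  Listing the n rows of (e, m) and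
-- discarding the empty ones identifies the orbits with the multiset partitions
-- having at most n blocks, which is all of Π when n ≥ 2r.  So u ↦ (u(shape(e, m)))
-- is a linear isomorphism, the structure constants of matrix multiplication being
-- the numbers of m such that (e, m, g) has a given shape ν; this number, for (e, g)
-- of shape ν|₀₂, is a multinomial coefficient equal to a_ν b_ν(n).
module Submission where

open import Defs
open import Algebra.Bundles using (CommutativeMonoid; CommutativeRing; Semiring)
open import Algebra.Module.Bundles using (LeftModule)
open import Algebra.Module.Morphism.Structures using (IsLeftModuleHomomorphism)
open import Algebra.Morphism.Structures using (IsSemiringHomomorphism)
import Algebra.Properties.CommutativeMonoid.Sum as CommutativeMonoidSum
import Algebra.Properties.CommutativeSemigroup as CommutativeSemigroupProperties
import Algebra.Properties.Ring as RingProperties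
open import Data.Bool.Base using (true; false; if_then_else_; _∧_)
open import Data.Fin.Base using (Fin; zero; suc; cast)
open import Data.Fin.Patterns using (0F; 1F; 2F)
open import Data.Fin.Permutation as Perm using (Permutation′; _⟨$⟩ˡ_; _⟨$⟩ʳ_; flip; _∘ₚ_)
import Data.Integer.Base as ℤ
import Data.Integer.Properties as ℤₚ
open import Data.List.Base as List
  using (List; []; _∷_; _++_; map; filter; foldr; length; replicate; upTo;
         cartesianProductWith; deduplicate)
import Data.List.Membership.DecPropositional as DecMembership
open import Data.List.Membership.Propositional using (_∈_; _∉_)
import Data.List.Membership.Propositional.Properties as ∈ₚ
import Data.List.Properties as Listₚ
open import Data.List.Relation.Binary.Permutation.Homogeneous using (onIndices)
open import Data.List.Relation.Binary.Permutation.Propositional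
  using (_↭_; prep; ↭-refl; ↭-sym; ↭-trans; ↭-reflexive; ↭⇒↭ₛ)
import Data.List.Relation.Binary.Permutation.Propositional.Properties as ↭ₚ
import Data.List.Relation.Binary.Permutation.Setoid.Properties as Permutationₛₚ
open import Data.List.Relation.Unary.All as All using (All; []; _∷_)
import Data.List.Relation.Unary.All.Properties as Allₚ
open import Data.List.Relation.Unary.AllPairs using ([]; _∷_)
open import Data.List.Relation.Unary.Any using (Any; here; there)
import Data.List.Relation.Unary.Unique.DecPropositional.Properties as DecUniqueₚ
open import Data.List.Relation.Unary.Unique.Propositional using (Unique)
import Data.List.Relation.Unary.Unique.Propositional.Properties as Uniqueₚ
import Data.List.Relation.Unary.Unique.Setoid as Uniqueₛ
open import Data.Nat.Base as ℕ using (ℕ; zero; suc; NonZero; _+_; _*_; _∸_; _!; _≤_; _<_; _≥_)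
open import Data.Nat.ListAction.Properties using (sum-↭)
import Data.Nat.Properties as ℕₚ
import Data.Nat.Solver as ℕ-Solver
open import Data.Product.Base using (_×_; _,_; ∃; proj₁; proj₂)
open import Data.Rational.Base as ℚ using (ℚ; 0ℚ; 1ℚ; fromℚᵘ)
import Data.Rational.Properties as ℚₚ
import Data.Rational.Solver as ℚ-Solver
open import Data.Rational.Unnormalised.Base as ℚᵘ using (mkℚᵘ; *≡*)
import Data.Rational.Unnormalised.Properties as ℚᵘₚ
open import Data.Sum.Base using (inj₁; inj₂; [_,_]′)
open import Data.Vec.Base as Vec using (Vec; []; _∷_; lookup; removeAt; tabulate; toList)
import Data.Vec.Properties as Vecₚ
open import Function.Base using (_∘_)
open import Function.Bundles using (Func)
open import Level using (0ℓ)
open import Relation.Binary.Bundles using (DecSetoid)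
open import Relation.Binary.Definitions using (DecidableEquality)
open import Relation.Binary.PropositionalEquality as ≡
  using (_≡_; _≢_; refl; cong; cong₂; subst; module ≡-Reasoning)
open import Relation.Nullary.Decidable using (Dec; yes; no; does; ¬?; map′; _×-dec_)
open import Relation.Nullary.Negation using (¬_; contradiction)
open import Relation.Unary using (Decidable)

-- Iterated operations over lists

-- The work lies in one count: the middle monomials completing given e and g to a triple of shape ν.
-- Padding ν with empty blocks to a list P of length n turns "has shape ν" into a permutation of
-- lists of length n. The copies of each row of (e, g) are distributed over the blocks of P
-- restricting to it, so the count, when it is not zero, is m(P|₀₂)! / m(P)!, where restriction
-- keeps empty blocks. These contribute (n - ℓ(ν|₀₂))! / (n - ℓ(ν))!, the falling factorial of
-- b_ν(n), because ℓ(ν) = ℓ(ν|₀₂) + ℓ(β). The other blocks contribute m(ν|₀₂)! / m(ν)! = a_ν /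
-- m(β)!, because ℓ(ν_S) is the multiplicity of S in ν|₀₂ and m(ν)! is m(β)! times the product of
-- the m(ν_S)!. All of this is proved in multiplied-out form and divided only once. A partition ν in
-- Γ can have up to 3r blocks, so n ≥ 2r does not exclude ℓ(ν) > n; then both the count and its
-- predicted value vanish.

does-≡ : ∀ {P Q : Set} (P? : Dec P) (Q? : Dec Q) → (P → Q) → (Q → P) → does P? ≡ does Q?
does-≡ (yes p) (yes q) _ _ = refl
does-≡ (yes p) (no ¬q) f _ = contradiction (f p) ¬q
does-≡ (no ¬p) (yes q) _ g = contradiction (g q) ¬p
does-≡ (no ¬p) (no ¬q) _ _ = refl

module ListFold (M : CommutativeMonoid 0ℓ 0ℓ) where

  open CommutativeMonoid M renaming (refl to ≈-refl)
  open import Relation.Binary.Reasoning.Setoid setoid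
  open CommutativeSemigroupProperties commutativeSemigroup using (interchange)

  fold : ∀ {A : Set} → List A → (A → Carrier) → Carrier
  fold xs f = foldr _∙_ ε (map f xs)

  module _ {A : Set} where

    fold-cong-∈ : ∀ (xs : List A) {f g : A → Carrier} → (∀ {x} → x ∈ xs → f x ≈ g x) →
                  fold xs f ≈ fold xs g
    fold-cong-∈ []       e = ≈-refl
    fold-cong-∈ (x ∷ xs) e = ∙-cong (e (here refl)) (fold-cong-∈ xs (e ∘ there))

    fold-cong : ∀ (xs : List A) {f g : A → Carrier} → (∀ x → f x ≈ g x) → fold xs f ≈ fold xs g
    fold-cong xs e = fold-cong-∈ xs λ {x} _ → e x

    fold-ε : ∀ (xs : List A) → fold xs (λ _ → ε) ≈ ε
    fold-ε []       = ≈-refl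
    fold-ε (x ∷ xs) = trans (identityˡ _) (fold-ε xs)

    fold-∙ : ∀ (xs : List A) (f g : A → Carrier) →
             fold xs (λ x → f x ∙ g x) ≈ fold xs f ∙ fold xs g
    fold-∙ []       f g = sym (identityˡ ε)
    fold-∙ (x ∷ xs) f g = trans (∙-congˡ (fold-∙ xs f g)) (interchange _ _ _ _)

    fold-++ : ∀ (xs ys : List A) (f : A → Carrier) → fold (xs ++ ys) f ≈ fold xs f ∙ fold ys f
    fold-++ []       ys f = sym (identityˡ _)
    fold-++ (x ∷ xs) ys f = trans (∙-congˡ (fold-++ xs ys f)) (sym (assoc _ _ _))

    fold-map : ∀ {B : Set} (h : B → A) (xs : List B) (f : A → Carrier) →
               fold (map h xs) f ≈ fold xs (f ∘ h)
    fold-map h []       f = ≈-refl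
    fold-map h (x ∷ xs) f = ∙-congˡ (fold-map h xs f)

    fold-filter : ∀ {P : A → Set} (P? : Decidable P) (xs : List A) (f : A → Carrier) →
                  fold (filter P? xs) f ≈ fold xs (λ x → if does (P? x) then f x else ε)
    fold-filter P? []       f = ≈-refl
    fold-filter P? (x ∷ xs) f with does (P? x)
    ... | true  = ∙-congˡ (fold-filter P? xs f)
    ... | false = trans (fold-filter P? xs f) (sym (identityˡ _))

    -- No law is asked of `_⊕_`, so the same lemma serves for evaluating a sum of functions at a
    -- point, for multiplying a sum by a constant and for casting a natural number into a ring.
    fold-homo : ∀ {C : Set} (_⊕_ : C → C → C) (0̂ : C) (h : C → Carrier) → h 0̂ ≈ ε →
                (∀ x y → h (x ⊕ y) ≈ h x ∙ h y) → ∀ (xs : List A) (f : A → C) →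
                h (foldr _⊕_ 0̂ (map f xs)) ≈ fold xs (h ∘ f)
    fold-homo _⊕_ 0̂ h z a []       f = z
    fold-homo _⊕_ 0̂ h z a (x ∷ xs) f = trans (a _ _) (∙-congˡ (fold-homo _⊕_ 0̂ h z a xs f))

  fold-comm : ∀ {A B : Set} (xs : List A) (ys : List B) (f : A → B → Carrier) →
              fold xs (λ x → fold ys (f x)) ≈ fold ys (λ y → fold xs (λ x → f x y))
  fold-comm []       ys f = sym (fold-ε ys)
  fold-comm (x ∷ xs) ys f =
    trans (∙-congˡ (fold-comm xs ys f)) (sym (fold-∙ ys (f x) λ y → fold xs λ x → f x y))

  fold-cartesianProductWith : ∀ {A B C : Set} (_∗_ : A → B → C) xs ys (f : C → Carrier) →
    fold (cartesianProductWith _∗_ xs ys) f ≈ fold xs (λ x → fold ys (λ y → f (x ∗ y)))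
  fold-cartesianProductWith _∗_ []       ys f = ≈-refl
  fold-cartesianProductWith _∗_ (x ∷ xs) ys f =
    trans (fold-++ (map (x ∗_) ys) (cartesianProductWith _∗_ xs ys) f)
      (∙-cong (fold-map (x ∗_) ys f) (fold-cartesianProductWith _∗_ xs ys f))

  module _ (S : DecSetoid 0ℓ 0ℓ) where
    private
      module S = DecSetoid S

    fold-none : ∀ {y} xs (f : S.Carrier → Carrier) → (∀ {x} → x ∈ xs → ¬ (y S.≈ x)) →
                fold xs (λ x → if does (y S.≟ x) then f x else ε) ≈ ε
    fold-none {y} xs f h = trans (fold-cong-∈ xs step) (fold-ε xs)
      where
      step : ∀ {x} → x ∈ xs → (if does (y S.≟ x) then f x else ε) ≈ ε
      step {x} x∈ with y S.≟ x
      ... | yes p = contradiction p (h x∈)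
      ... | no  _ = ≈-refl

    -- A duplicate-free list meets the class of `y` exactly once, possibly in another
    -- representative; hence `f` is required to be constant on that class.
    fold-pick : ∀ {y xs c} (f : S.Carrier → Carrier) → Uniqueₛ.Unique S.setoid xs → Any (y S.≈_) xs →
                (∀ {x} → y S.≈ x → f x ≈ c) →
                fold xs (λ x → if does (y S.≟ x) then f x else ε) ≈ c
    fold-pick {y} {x ∷ xs} f (x∉ ∷ xs!) y∈ e with y S.≟ x
    ... | yes p = trans (∙-cong (e p) (fold-none xs f (none x∉))) (identityʳ _)
      where
      none : ∀ {xs} → All (λ z → ¬ (x S.≈ z)) xs → ∀ {z} → z ∈ xs → ¬ (y S.≈ z)
      none (q ∷ _)  (here refl) r = q (S.trans (S.sym p) r)
      none (_ ∷ qs) (there z∈)  r = none qs z∈ r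
    ... | no ¬p with y∈
    ...   | here p  = contradiction p ¬p
    ...   | there a = trans (identityˡ _) (fold-pick f xs! a e)

  module _ {A : Set} (_≟_ : DecidableEquality A) where

    fold-pick-≡ : ∀ {y : A} {xs} (f : A → Carrier) → Unique xs → y ∈ xs →
                  fold xs (λ x → if does (y ≟ x) then f x else ε) ≈ f y
    fold-pick-≡ f xs! y∈ = fold-pick (≡.decSetoid _≟_) f xs! y∈ λ { refl → ≈-refl }

    -- Each `f (σ x)` is written as a sum over y with the indicator of `σ x ≡ y`; after exchanging
    -- the sums the condition reads `τ y ≡ x`, which selects one x for every y.
    fold-reindex : ∀ {xs} → Unique xs → (∀ x → x ∈ xs) → (σ τ : A → A) →
                   (∀ x → τ (σ x) ≡ x) → (∀ x → σ (τ x) ≡ x) → (f : A → Carrier) →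
                   fold xs (f ∘ σ) ≈ fold xs f
    fold-reindex {xs} xs! all σ τ τσ στ f = begin
      fold xs (f ∘ σ)
        ≈⟨ fold-cong xs (λ x → fold-pick-≡ f xs! (all (σ x))) ⟨
      fold xs (λ x → fold xs (λ y → if does (σ x ≟ y) then f y else ε))
        ≈⟨ fold-comm xs xs _ ⟩
      fold xs (λ y → fold xs (λ x → if does (σ x ≟ y) then f y else ε))
        ≈⟨ fold-cong xs (λ y → fold-cong xs λ x → reflexive
             (≡.cong (λ b → if b then f y else ε)
               (does-≡ (σ x ≟ y) (τ y ≟ x) (λ { refl → τσ x }) (λ { refl → στ y })))) ⟩
      fold xs (λ y → fold xs (λ x → if does (τ y ≟ x) then f y else ε))
        ≈⟨ fold-cong xs (λ y → fold-pick-≡ (λ _ → f y) xs! (all (τ y))) ⟩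
      fold xs f ∎

-- Counting the matrices with prescribed rows

module Σℕ = ListFold ℕₚ.+-0-commutativeMonoid
module Πℕ = ListFold ℕₚ.*-1-commutativeMonoid

𝟙 : ∀ {P : Set} → Dec P → ℕ
𝟙 d = if does d then 1 else 0

𝟙-cong : ∀ {P Q : Set} (P? : Dec P) (Q? : Dec Q) → (P → Q) → (Q → P) → 𝟙 P? ≡ 𝟙 Q?
𝟙-cong P? Q? f g = cong (λ b → if b then 1 else 0) (does-≡ P? Q? f g)

length-filter-∷ : ∀ {A : Set} {P : A → Set} (P? : Decidable P) x xs →
                  length (filter P? (x ∷ xs)) ≡ 𝟙 (P? x) + length (filter P? xs)
length-filter-∷ P? x xs with does (P? x)
... | true  = refl
... | false = refl

module _ {d k : ℕ} where

  -- m! as a recursion along the list, see m!≡mult!.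
  mult! : List (Block d k) → ℕ
  mult! []       = 1
  mult! (T ∷ Ts) = suc (multiplicity T Ts) * mult! Ts

  multiplicity-∷ : ∀ (S T : Block d k) Ts →
                   multiplicity S (T ∷ Ts) ≡ 𝟙 (T ≟ᴮ S) + multiplicity S Ts
  multiplicity-∷ S = length-filter-∷ (_≟ᴮ S)

  multiplicity-↭ : ∀ (S : Block d k) {Ts Us} → Ts ↭ Us → multiplicity S Ts ≡ multiplicity S Us
  multiplicity-↭ S p = ↭ₚ.↭-length (↭ₚ.filter-↭ (_≟ᴮ S) p)

  multiplicity-∉ : ∀ (S : Block d k) {Ts} → (∀ {T} → T ∈ Ts → T ≢ S) → multiplicity S Ts ≡ 0
  multiplicity-∉ S {[]}     h = refl
  multiplicity-∉ S {T ∷ Ts} h with T ≟ᴮ S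
  ... | yes p = contradiction p (h (here refl))
  ... | no  _ = multiplicity-∉ S (h ∘ there)

  multiplicity-head : ∀ (T : Block d k) Ts → multiplicity T (T ∷ Ts) ≡ suc (multiplicity T Ts)
  multiplicity-head T Ts with T ≟ᴮ T
  ... | yes _ = refl
  ... | no ¬p = contradiction refl ¬p

  -- Only an adjacent swap has content: for distinct blocks the two leading factors trade places,
  -- and for equal blocks nothing moves.
  mult!-↭ : ∀ {Ts Us} → Ts ↭ Us → mult! Ts ≡ mult! Us
  mult!-↭ _↭_.refl        = refl
  mult!-↭ (prep T p)      = cong₂ (λ a b → suc a * b) (multiplicity-↭ T p) (mult!-↭ p)
  mult!-↭ (_↭_.trans p q) = ≡.trans (mult!-↭ p) (mult!-↭ q)
  mult!-↭ {Ts = _ ∷ _ ∷ Ts} {Us = _ ∷ _ ∷ Us} (_↭_.swap S T p) with T ≟ᴮ S | S ≟ᴮ T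
  ... | yes refl | yes _ =
    cong₂ (λ a b → suc (suc a) * (suc a * b)) (multiplicity-↭ T p) (mult!-↭ p)
  ... | yes refl | no ¬q = contradiction refl ¬q
  ... | no ¬q | yes refl = contradiction refl ¬q
  ... | no _  | no _     =
    ≡.trans (rearrange (suc (multiplicity S Ts)) (suc (multiplicity T Ts)) (mult! Ts))
      (cong₂ _*_ (cong suc (multiplicity-↭ T p))
        (cong₂ _*_ (cong suc (multiplicity-↭ S p)) (mult!-↭ p)))
    where
    rearrange : ∀ a b c → a * (b * c) ≡ b * (a * c)
    rearrange = solve 3 (λ a b c → a :* (b :* c) := b :* (a :* c)) refl
      where open ℕ-Solver.+-*-Solver

  -- Prepending `T` changes only the factor at `S = T`, by `suc (multiplicity T Ts)`. Letting `Ss`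
  -- be any duplicate-free list that covers `Ts` keeps it fixed during the induction; entries absent
  -- from `Ts` contribute 0! = 1.
  ∏-multiplicity! : ∀ {Ss} → Unique Ss → ∀ Ts → (∀ {T} → T ∈ Ts → T ∈ Ss) →
                    Πℕ.fold Ss (λ S → multiplicity S Ts !) ≡ mult! Ts
  ∏-multiplicity! {Ss} Ss! []       ∈Ss = Πℕ.fold-ε Ss
  ∏-multiplicity! {Ss} Ss! (T ∷ Ts) ∈Ss = begin
    Πℕ.fold Ss (λ S → multiplicity S (T ∷ Ts) !)
      ≡⟨ Πℕ.fold-cong Ss step ⟩
    Πℕ.fold Ss (λ S → (if does (T ≟ᴮ S) then suc (multiplicity S Ts) else 1) * multiplicity S Ts !)
      ≡⟨ Πℕ.fold-∙ Ss _ _ ⟩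
    Πℕ.fold Ss (λ S → if does (T ≟ᴮ S) then suc (multiplicity S Ts) else 1) *
    Πℕ.fold Ss (λ S → multiplicity S Ts !)
      ≡⟨ cong₂ _*_ (Πℕ.fold-pick-≡ _≟ᴮ_ _ Ss! (∈Ss (here refl)))
           (∏-multiplicity! Ss! Ts (∈Ss ∘ there)) ⟩
    mult! (T ∷ Ts) ∎
    where
    open ≡-Reasoning
    step : ∀ S → multiplicity S (T ∷ Ts) ! ≡
                 (if does (T ≟ᴮ S) then suc (multiplicity S Ts) else 1) * multiplicity S Ts !
    step S with does (T ≟ᴮ S)
    ... | true  = refl
    ... | false = ≡.sym (ℕₚ.*-identityˡ _)

  m!≡mult! : ∀ Ts → m! Ts ≡ mult! Ts
  m!≡mult! Ts = ∏-multiplicity! (DecUniqueₚ.deduplicate-! _≟ᴮ_ Ts) Ts (∈ₚ.∈-deduplicate⁺ _≟ᴮ_)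

  -- Equal blocks lie in the same fiber of `f`, so a block has the same multiplicity in its fiber as
  -- in the whole list. For `f = drop₁` this assembles m(β)! and the m(ν_S)! into m(ν)!.
  ∏-fibers : ∀ {d′} (f : Block d k → Block d′ k) {Ss} → Unique Ss →
             ∀ Ts → (∀ {T} → T ∈ Ts → f T ∈ Ss) →
             Πℕ.fold Ss (λ S → mult! (filter (λ T → f T ≟ᴮ S) Ts)) ≡ mult! Ts
  ∏-fibers f {Ss} Ss! []       ∈Ss = Πℕ.fold-ε Ss
  ∏-fibers f {Ss} Ss! (T ∷ Ts) ∈Ss = begin
    Πℕ.fold Ss (λ S → mult! (filter (λ T → f T ≟ᴮ S) (T ∷ Ts)))
      ≡⟨ Πℕ.fold-cong Ss step ⟩
    Πℕ.fold Ss (λ S → (if does (f T ≟ᴮ S) then suc (multiplicity T Ts) else 1) *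
                       mult! (filter (λ T → f T ≟ᴮ S) Ts))
      ≡⟨ Πℕ.fold-∙ Ss _ _ ⟩
    Πℕ.fold Ss (λ S → if does (f T ≟ᴮ S) then suc (multiplicity T Ts) else 1) *
    Πℕ.fold Ss (λ S → mult! (filter (λ T → f T ≟ᴮ S) Ts))
      ≡⟨ cong₂ _*_ (Πℕ.fold-pick-≡ _≟ᴮ_ _ Ss! (∈Ss (here refl))) (∏-fibers f Ss! Ts (∈Ss ∘ there)) ⟩
    mult! (T ∷ Ts) ∎
    where
    open ≡-Reasoning
    multiplicity-fiber : ∀ Us → multiplicity T (filter (λ U → f U ≟ᴮ f T) Us) ≡ multiplicity T Us
    multiplicity-fiber []       = refl
    multiplicity-fiber (U ∷ Us) with f U ≟ᴮ f T | U ≟ᴮ T in eq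
    ... | yes _ | yes p rewrite eq = cong suc (multiplicity-fiber Us)
    ... | yes _ | no ¬p rewrite eq = multiplicity-fiber Us
    ... | no ¬q | yes p = contradiction (cong f p) ¬q
    ... | no _  | no ¬p = multiplicity-fiber Us
    step : ∀ S → mult! (filter (λ T → f T ≟ᴮ S) (T ∷ Ts)) ≡
                 (if does (f T ≟ᴮ S) then suc (multiplicity T Ts) else 1) *
                 mult! (filter (λ T → f T ≟ᴮ S) Ts)
    step S with f T ≟ᴮ S
    ... | yes refl = cong (λ a → suc a * mult! (filter (λ U → f U ≟ᴮ f T) Ts)) (multiplicity-fiber Ts)
    ... | no _ = ≡.sym (ℕₚ.*-identityˡ _)

rows : ∀ {d n k} → Vec (Vec (Vec ℕ k) n) d → List (Block d k)
rows es = toList (tabulate λ i → Vec.map (λ e → lookup e i) es)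

drop₁ : ∀ {k} → Block 3 k → Block 2 k
drop₁ T = removeAt T 1F

module _ {k : ℕ} {X : List (Vec ℕ k)} (X! : Unique X) where

  private
    _↭?_ : ∀ {d} → (Ts Us : List (Block d k)) → Dec (Ts ↭ Us)
    _↭?_ = ↭-dec _≟ᴮ_

  -- A block of `Ts` restricting to (e, g) is counted for exactly one x, its own middle row, which
  -- `X` contains by assumption.
  ∑-multiplicity : ∀ e g (Ts : List (Block 3 k)) → (∀ {T} → T ∈ Ts → lookup T 1F ∈ X) →
                   Σℕ.fold X (λ x → multiplicity (e ∷ x ∷ g ∷ []) Ts) ≡
                   multiplicity (e ∷ g ∷ []) (map drop₁ Ts)
  ∑-multiplicity e g []                     ∈X = Σℕ.fold-ε X
  ∑-multiplicity e g (T@(a ∷ b ∷ c ∷ []) ∷ Ts) ∈X = begin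
    Σℕ.fold X (λ x → multiplicity (e ∷ x ∷ g ∷ []) (T ∷ Ts))
      ≡⟨ Σℕ.fold-cong X (λ x → ≡.trans (multiplicity-∷ _ T Ts) (cong (_+ _) (step x (b ≟ⱽ x)))) ⟩
    Σℕ.fold X (λ x → (if does (b ≟ⱽ x) then 𝟙 (drop₁ T ≟ᴮ S) else 0) + multiplicity (e ∷ x ∷ g ∷ []) Ts)
      ≡⟨ Σℕ.fold-∙ X _ _ ⟩
    Σℕ.fold X (λ x → if does (b ≟ⱽ x) then 𝟙 (drop₁ T ≟ᴮ S) else 0) +
    Σℕ.fold X (λ x → multiplicity (e ∷ x ∷ g ∷ []) Ts)
      ≡⟨ cong₂ _+_ (Σℕ.fold-pick-≡ _≟ⱽ_ _ X! (∈X (here refl))) (∑-multiplicity e g Ts (∈X ∘ there)) ⟩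
    𝟙 (drop₁ T ≟ᴮ S) + multiplicity S (map drop₁ Ts)
      ≡⟨ multiplicity-∷ S (drop₁ T) (map drop₁ Ts) ⟨
    multiplicity S (map drop₁ (T ∷ Ts)) ∎
    where
    open ≡-Reasoning
    S : Block 2 k
    S = e ∷ g ∷ []
    _≟ⱽ_ = Vecₚ.≡-dec ℕₚ._≟_
    step : ∀ x (b? : Dec (b ≡ x)) →
           𝟙 (T ≟ᴮ (e ∷ x ∷ g ∷ [])) ≡ (if does b? then 𝟙 (drop₁ T ≟ᴮ S) else 0)
    step x (yes refl) = 𝟙-cong (T ≟ᴮ (e ∷ b ∷ g ∷ [])) (drop₁ T ≟ᴮ S) (λ { refl → refl }) (λ { refl → refl })
    step x (no b≢x)   = 𝟙-cong (T ≟ᴮ (e ∷ x ∷ g ∷ [])) (no λ ()) (λ { refl → b≢x refl }) (λ ())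

  -- A middle entry x of the first row uses up one of the copies of the block
  -- (e, x, g) in N; the multiplicities of these blocks sum over x to that of (e, g)
  -- in N|₀₂.  Multiplying by mult! N avoids the division.
  count-fillings : ∀ {n} (e g : Vec (Vec ℕ k) n) (N : List (Block 3 k)) →
    (∀ {T} → T ∈ N → lookup T 1F ∈ X) →
    Σℕ.fold (tuples X n) (λ x → 𝟙 (rows (e ∷ x ∷ g ∷ []) ↭? N)) * mult! N ≡
    𝟙 (map drop₁ N ↭? rows (e ∷ g ∷ [])) * mult! (rows (e ∷ g ∷ []))
  count-fillings [] [] []      ∈X = refl
  count-fillings [] [] (T ∷ N) ∈X = refl
  count-fillings {suc n} (e ∷ es) (g ∷ gs) N ∈X = begin
    Σℕ.fold (tuples X (suc n)) (λ x → 𝟙 (rows ((e ∷ es) ∷ x ∷ (g ∷ gs) ∷ []) ↭? N)) * mult! N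
      ≡⟨ cong (_* mult! N) (Σℕ.fold-cartesianProductWith _∷_ X (tuples X n) _) ⟩
    Σℕ.fold X inner * mult! N
      ≡⟨ Σℕ.fold-homo _+_ 0 (_* mult! N) refl (λ a b → ℕₚ.*-distribʳ-+ (mult! N) a b) X inner ⟩
    Σℕ.fold X (λ x → inner x * mult! N)
      ≡⟨ Σℕ.fold-cong X (λ x → step x (DecMembership._∈?_ _≟ᴮ_ (e ∷ x ∷ g ∷ []) N)) ⟩
    Σℕ.fold X (λ x → multiplicity (e ∷ x ∷ g ∷ []) N * c)
      ≡⟨ Σℕ.fold-homo _+_ 0 (_* c) refl (λ a b → ℕₚ.*-distribʳ-+ c a b) X _ ⟨
    Σℕ.fold X (λ x → multiplicity (e ∷ x ∷ g ∷ []) N) * c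
      ≡⟨ cong (_* c) (∑-multiplicity e g N ∈X) ⟩
    multiplicity S (map drop₁ N) * c
      ≡⟨ final ⟩
    𝟙 (map drop₁ N ↭? (S ∷ R)) * mult! (S ∷ R) ∎
    where
    open ≡-Reasoning
    S : Block 2 k
    S = e ∷ g ∷ []
    R : List (Block 2 k)
    R = rows (es ∷ gs ∷ [])
    c = 𝟙 (map drop₁ N ↭? (S ∷ R)) * mult! R
    inner : Vec ℕ k → ℕ
    inner x = Σℕ.fold (tuples X n) (λ xs → 𝟙 (((e ∷ x ∷ g ∷ []) ∷ rows (es ∷ xs ∷ gs ∷ [])) ↭? N))

    absent : ∀ x → (e ∷ x ∷ g ∷ []) ∉ N → inner x * mult! N ≡ multiplicity (e ∷ x ∷ g ∷ []) N * c
    absent x T∉N = begin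
      inner x * mult! N
        ≡⟨ cong (_* mult! N) (Σℕ.fold-cong (tuples X n) λ xs →
             𝟙-cong (_ ↭? N) (no λ ()) (λ p → T∉N (↭ₚ.∈-resp-↭ p (here refl))) (λ ())) ⟩
      Σℕ.fold (tuples X n) (λ _ → 0) * mult! N
        ≡⟨ cong (_* mult! N) (Σℕ.fold-ε (tuples X n)) ⟩
      0
        ≡⟨ cong (_* c) (multiplicity-∉ (e ∷ x ∷ g ∷ []) λ { T∈ refl → T∉N T∈ }) ⟨
      multiplicity (e ∷ x ∷ g ∷ []) N * c ∎

    -- Placing the block in the first row leaves the same problem for `N′` and the remaining rows.
    -- Passing from `mult! N′` to `mult! N` costs exactly the multiplicity of the block in `N`,
    -- which is the weight on the right.
    present : ∀ x {N′} → N ↭ (e ∷ x ∷ g ∷ []) ∷ N′ →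
              inner x * mult! N ≡ multiplicity (e ∷ x ∷ g ∷ []) N * c
    present x {N′} N↭ = begin
      inner x * mult! N
        ≡⟨ cong₂ _*_
             (Σℕ.fold-cong (tuples X n) λ xs → 𝟙-cong (_ ↭? N) (rows (es ∷ xs ∷ gs ∷ []) ↭? N′)
               (λ p → ↭ₚ.drop-∷ (↭-trans p N↭)) (λ p → ↭-trans (prep T p) (↭-sym N↭)))
             (mult!-↭ N↭) ⟩
      count′ * (suc (multiplicity T N′) * mult! N′)
        ≡⟨ solve 3 (λ a b c → a :* (b :* c) := b :* (a :* c)) refl
             count′ (suc (multiplicity T N′)) (mult! N′) ⟩
      suc (multiplicity T N′) * (count′ * mult! N′)
        ≡⟨ cong₂ _*_
             (≡.sym (≡.trans (multiplicity-↭ T N↭) (multiplicity-head T N′)))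
             (count-fillings es gs N′ λ U∈ → ∈X (↭ₚ.∈-resp-↭ (↭-sym N↭) (there U∈))) ⟩
      multiplicity T N * (𝟙 (map drop₁ N′ ↭? R) * mult! R)
        ≡⟨ cong (λ a → multiplicity T N * (a * mult! R))
             (𝟙-cong (map drop₁ N′ ↭? R) (map drop₁ N ↭? (S ∷ R))
               (λ p → ↭-trans (↭ₚ.map⁺ drop₁ N↭) (prep S p))
               (λ p → ↭ₚ.drop-∷ (↭-trans (↭-sym (↭ₚ.map⁺ drop₁ N↭)) p))) ⟩
      multiplicity T N * c ∎
      where
      open ℕ-Solver.+-*-Solver
      T : Block 3 k
      T = e ∷ x ∷ g ∷ []
      count′ = Σℕ.fold (tuples X n) (λ xs → 𝟙 (rows (es ∷ xs ∷ gs ∷ []) ↭? N′))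

    step : ∀ x → Dec ((e ∷ x ∷ g ∷ []) ∈ N) →
           inner x * mult! N ≡ multiplicity (e ∷ x ∷ g ∷ []) N * c
    step x (no T∉N)  = absent x T∉N
    step x (yes T∈N) = let as , bs , N≡ = ∈ₚ.∈-∃++ T∈N in
      present x {as ++ bs} (↭-trans (↭-reflexive N≡) (↭ₚ.shift (e ∷ x ∷ g ∷ []) as bs))

    -- When the indicator is 1, the multiplicity of `S` is `suc (multiplicity S R)`, the factor by
    -- which `mult! (S ∷ R)` exceeds `mult! R`.
    final : multiplicity S (map drop₁ N) * c ≡ 𝟙 (map drop₁ N ↭? (S ∷ R)) * mult! (S ∷ R)
    final with map drop₁ N ↭? (S ∷ R)
    ... | yes p = begin
      multiplicity S (map drop₁ N) * (1 * mult! R)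
        ≡⟨ cong₂ _*_ (≡.trans (multiplicity-↭ S p) (multiplicity-head S R)) (ℕₚ.*-identityˡ _) ⟩
      mult! (S ∷ R)
        ≡⟨ ℕₚ.*-identityˡ _ ⟨
      1 * mult! (S ∷ R) ∎
    ... | no _ = ℕₚ.*-zeroʳ (multiplicity S (map drop₁ N))

-- The rational number a_ν b_ν(n)

-- Unnormalised fractions have sums and products given by plain formulas, so identities between
-- quotients are checked there and carried over to the normalised rationals.
fromℚᵘ-homo-* : ∀ p q → fromℚᵘ (p ℚᵘ.* q) ≡ fromℚᵘ p ℚ.* fromℚᵘ q
fromℚᵘ-homo-* p q = ℚₚ.toℚᵘ-injective (ℚᵘₚ.≃-trans (ℚₚ.toℚᵘ-fromℚᵘ (p ℚᵘ.* q)) (ℚᵘₚ.≃-sym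
  (ℚᵘₚ.≃-trans (ℚₚ.toℚᵘ-homo-* (fromℚᵘ p) (fromℚᵘ q))
    (ℚᵘₚ.*-cong (ℚₚ.toℚᵘ-fromℚᵘ p) (ℚₚ.toℚᵘ-fromℚᵘ q)))))

fromℚᵘ-homo-+ : ∀ p q → fromℚᵘ (p ℚᵘ.+ q) ≡ fromℚᵘ p ℚ.+ fromℚᵘ q
fromℚᵘ-homo-+ p q = ℚₚ.toℚᵘ-injective (ℚᵘₚ.≃-trans (ℚₚ.toℚᵘ-fromℚᵘ (p ℚᵘ.+ q)) (ℚᵘₚ.≃-sym
  (ℚᵘₚ.≃-trans (ℚₚ.toℚᵘ-homo-+ (fromℚᵘ p) (fromℚᵘ q))
    (ℚᵘₚ.+-cong (ℚₚ.toℚᵘ-fromℚᵘ p) (ℚₚ.toℚᵘ-fromℚᵘ q)))))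

fromℕ-* : ∀ m n → fromℕ (m * n) ≡ fromℕ m ℚ.* fromℕ n
fromℕ-* m n = ≡.trans (cong (ℚ._/ 1) (ℤₚ.pos-* m n))
  (fromℚᵘ-homo-* (mkℚᵘ (ℤ.+ m) 0) (mkℚᵘ (ℤ.+ n) 0))

fromℕ-+ : ∀ m n → fromℕ (m + n) ≡ fromℕ m ℚ.+ fromℕ n
fromℕ-+ m n = ≡.trans
  (cong (ℚ._/ 1) (cong₂ ℤ._+_ (≡.sym (ℤₚ.*-identityʳ (ℤ.+ m))) (≡.sym (ℤₚ.*-identityʳ (ℤ.+ n)))))
  (fromℚᵘ-homo-+ (mkℚᵘ (ℤ.+ m) 0) (mkℚᵘ (ℤ.+ n) 0))

/-*-fromℕ : ∀ p d .{{_ : NonZero d}} → (ℤ.+ p ℚ./ d) ℚ.* fromℕ d ≡ fromℕ p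
/-*-fromℕ p (suc d) = ≡.trans (≡.sym (fromℚᵘ-homo-* (mkℚᵘ (ℤ.+ p) d) (mkℚᵘ (ℤ.+ suc d) 0)))
  (ℚₚ.fromℚᵘ-cong {mkℚᵘ (ℤ.+ p) d ℚᵘ.* mkℚᵘ (ℤ.+ suc d) 0} {mkℚᵘ (ℤ.+ p) 0} (*≡* (≡.trans (ℤₚ.*-identityʳ _)
    (cong (λ e → ℤ.+ p ℤ.* ℤ.+ suc e) (≡.sym (ℕₚ.*-identityʳ d))))))

fromℕ-cancelʳ : ∀ d .{{_ : NonZero d}} p q → p ℚ.* fromℕ d ≡ q ℚ.* fromℕ d → p ≡ q
fromℕ-cancelʳ d p q eq = begin
  p                                    ≡⟨ undo p ⟨
  p ℚ.* fromℕ d ℚ.* (ℤ.+ 1 ℚ./ d)      ≡⟨ cong (ℚ._* (ℤ.+ 1 ℚ./ d)) eq ⟩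
  q ℚ.* fromℕ d ℚ.* (ℤ.+ 1 ℚ./ d)      ≡⟨ undo q ⟩
  q                                    ∎
  where
  open ≡-Reasoning
  undo : ∀ p → p ℚ.* fromℕ d ℚ.* (ℤ.+ 1 ℚ./ d) ≡ p
  undo p = begin
    p ℚ.* fromℕ d ℚ.* (ℤ.+ 1 ℚ./ d)    ≡⟨ ℚₚ.*-assoc p (fromℕ d) (ℤ.+ 1 ℚ./ d) ⟩
    p ℚ.* (fromℕ d ℚ.* (ℤ.+ 1 ℚ./ d))  ≡⟨ cong (p ℚ.*_) (ℚₚ.*-comm (fromℕ d) (ℤ.+ 1 ℚ./ d)) ⟩
    p ℚ.* ((ℤ.+ 1 ℚ./ d) ℚ.* fromℕ d)  ≡⟨ cong (p ℚ.*_) (/-*-fromℕ 1 d) ⟩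
    p ℚ.* 1ℚ                           ≡⟨ ℚₚ.*-identityʳ p ⟩
    p                                  ∎

fromℕ-∸ : ∀ {m n} → n ≤ m → fromℕ m ℚ.- fromℕ n ≡ fromℕ (m ∸ n)
fromℕ-∸ {m} {n} n≤m = begin
  fromℕ m ℚ.- fromℕ n                       ≡⟨ cong (λ m → fromℕ m ℚ.- fromℕ n) (ℕₚ.m∸n+n≡m n≤m) ⟨
  fromℕ (m ∸ n + n) ℚ.- fromℕ n             ≡⟨ cong (ℚ._- fromℕ n) (fromℕ-+ (m ∸ n) n) ⟩
  fromℕ (m ∸ n) ℚ.+ fromℕ n ℚ.- fromℕ n
    ≡⟨ solve 2 (λ a b → (a :+ b) :- b := a) refl (fromℕ (m ∸ n)) (fromℕ n) ⟩
  fromℕ (m ∸ n)                             ∎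
  where
  open ≡-Reasoning
  open ℚ-Solver.+-*-Solver using (solve; _:=_; _:+_; _:*_; _:-_)

falling-≤ : ∀ {m s} → s ≤ m → falling (fromℕ m) s ℚ.* fromℕ ((m ∸ s) !) ≡ fromℕ (m !)
falling-≤ {m}     {zero}  _            = ℚₚ.*-identityˡ _
falling-≤ {suc m} {suc s} (ℕ.s≤s s≤m) = begin
  fromℕ (suc m) ℚ.* falling (fromℕ (suc m) ℚ.- 1ℚ) s ℚ.* fromℕ ((m ∸ s) !)
    ≡⟨ cong (λ x → fromℕ (suc m) ℚ.* falling x s ℚ.* fromℕ ((m ∸ s) !)) (fromℕ-∸ {suc m} {1} (ℕ.s≤s ℕ.z≤n)) ⟩
  fromℕ (suc m) ℚ.* falling (fromℕ m) s ℚ.* fromℕ ((m ∸ s) !)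
    ≡⟨ ℚₚ.*-assoc (fromℕ (suc m)) (falling (fromℕ m) s) _ ⟩
  fromℕ (suc m) ℚ.* (falling (fromℕ m) s ℚ.* fromℕ ((m ∸ s) !))
    ≡⟨ cong (fromℕ (suc m) ℚ.*_) (falling-≤ s≤m) ⟩
  fromℕ (suc m) ℚ.* fromℕ (m !)
    ≡⟨ fromℕ-* (suc m) (m !) ⟨
  fromℕ (suc m !) ∎
  where open ≡-Reasoning

-- The factors descend from m in steps of 1, and more than m of them reach the factor 0.
falling-> : ∀ {m s} → m < s → falling (fromℕ m) s ≡ 0ℚ
falling-> {zero}  {suc s} _           = ℚₚ.*-zeroˡ (falling (0ℚ ℚ.- 1ℚ) s)
falling-> {suc m} {suc s} (ℕ.s≤s m<s) = begin
  fromℕ (suc m) ℚ.* falling (fromℕ (suc m) ℚ.- 1ℚ) s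
    ≡⟨ cong (λ x → fromℕ (suc m) ℚ.* falling x s) (fromℕ-∸ {suc m} {1} (ℕ.s≤s ℕ.z≤n)) ⟩
  fromℕ (suc m) ℚ.* falling (fromℕ m) s
    ≡⟨ cong (fromℕ (suc m) ℚ.*_) (falling-> m<s) ⟩
  fromℕ (suc m) ℚ.* 0ℚ
    ≡⟨ ℚₚ.*-zeroʳ (fromℕ (suc m)) ⟩
  0ℚ ∎
  where open ≡-Reasoning

mult!-nonZero : ∀ {d k} (Ts : List (Block d k)) → NonZero (mult! Ts)
mult!-nonZero []       = _
mult!-nonZero (T ∷ Ts) = ℕₚ.m*n≢0 (suc (multiplicity T Ts)) (mult! Ts) {{_}} {{mult!-nonZero Ts}}

-- Discarding and restoring empty blocks

nonEmpty : ∀ {d k} → List (Block d k) → List (Block d k)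
nonEmpty = filter (λ T → ¬? (T ≟ᴮ ∅))

module _ {d k : ℕ} where

  nonEmpty-all : {Ts : List (Block d k)} → All (_≢ ∅) Ts → nonEmpty Ts ≡ Ts
  nonEmpty-all = Listₚ.filter-all (λ T → ¬? (T ≟ᴮ ∅))

  length-multiplicity-∅ : (Ts : List (Block d k)) → length Ts ≡ multiplicity ∅ Ts + length (nonEmpty Ts)
  length-multiplicity-∅ []       = refl
  length-multiplicity-∅ (T ∷ Ts) with T ≟ᴮ ∅
  ... | yes _ = cong suc (length-multiplicity-∅ Ts)
  ... | no  _ = ≡.trans (cong suc (length-multiplicity-∅ Ts)) (≡.sym (ℕₚ.+-suc _ _))

  ↭-∅-nonEmpty : (Ts : List (Block d k)) → Ts ↭ replicate (multiplicity ∅ Ts) ∅ ++ nonEmpty Ts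
  ↭-∅-nonEmpty []       = ↭-refl
  ↭-∅-nonEmpty (T ∷ Ts) with T ≟ᴮ ∅
  ... | yes refl = prep ∅ (↭-∅-nonEmpty Ts)
  ... | no  _ = ↭-trans (prep T (↭-∅-nonEmpty Ts))
                  (↭-sym (↭ₚ.shift T (replicate (multiplicity ∅ Ts) ∅) (nonEmpty Ts)))

  -- The length determines how many empty blocks were discarded.
  nonEmpty-↭⁻ : {Ts Us : List (Block d k)} → length Ts ≡ length Us → nonEmpty Ts ↭ nonEmpty Us → Ts ↭ Us
  nonEmpty-↭⁻ {Ts} {Us} len p = ↭-trans (↭-∅-nonEmpty Ts) (↭-trans
    (subst (λ j → replicate (multiplicity ∅ Ts) ∅ ++ nonEmpty Ts ↭ replicate j ∅ ++ nonEmpty Us) mult≡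
      (↭ₚ.++⁺ˡ (replicate (multiplicity ∅ Ts) ∅) p))
    (↭-sym (↭-∅-nonEmpty Us)))
    where
    mult≡ : multiplicity ∅ Ts ≡ multiplicity ∅ Us
    mult≡ = ℕₚ.+-cancelʳ-≡ (length (nonEmpty Us)) _ _ (begin
      multiplicity ∅ Ts + length (nonEmpty Us) ≡⟨ cong (multiplicity ∅ Ts +_) (↭ₚ.↭-length p) ⟨
      multiplicity ∅ Ts + length (nonEmpty Ts) ≡⟨ length-multiplicity-∅ Ts ⟨
      length Ts                                ≡⟨ len ⟩
      length Us                                ≡⟨ length-multiplicity-∅ Us ⟩
      multiplicity ∅ Us + length (nonEmpty Us) ∎)
      where open ≡-Reasoning

  nonEmpty-↭⁺ : {Ts Us : List (Block d k)} → Ts ↭ Us → nonEmpty Ts ↭ nonEmpty Us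
  nonEmpty-↭⁺ = ↭ₚ.filter-↭ (λ T → ¬? (T ≟ᴮ ∅))

  -- Adds nothing when Ts has more than n blocks.
  pad : ℕ → List (Block d k) → List (Block d k)
  pad n Ts = replicate (n ∸ length Ts) ∅ ++ Ts

  length-pad : ∀ {n} (Ts : List (Block d k)) → length Ts ≤ n → length (pad n Ts) ≡ n
  length-pad {n} Ts le = ≡.trans (Listₚ.length-++ (replicate (n ∸ length Ts) ∅))
    (≡.trans (cong (_+ length Ts) (Listₚ.length-replicate (n ∸ length Ts))) (ℕₚ.m∸n+n≡m le))

  nonEmpty-replicate : ∀ j (Ts : List (Block d k)) → nonEmpty (replicate j ∅ ++ Ts) ≡ nonEmpty Ts
  nonEmpty-replicate zero    Ts = refl
  nonEmpty-replicate (suc j) Ts = ≡.trans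
    (Listₚ.filter-reject (λ T → ¬? (T ≟ᴮ ∅)) (λ h → h refl))
    (nonEmpty-replicate j Ts)

  nonEmpty-pad : ∀ n {Ts : List (Block d k)} → All (_≢ ∅) Ts → nonEmpty (pad n Ts) ≡ Ts
  nonEmpty-pad n {Ts} ≢∅ = ≡.trans (nonEmpty-replicate (n ∸ length Ts) Ts) (nonEmpty-all ≢∅)

  mult!-replicate : ∀ j {Ts : List (Block d k)} → All (_≢ ∅) Ts → mult! (replicate j ∅ ++ Ts) ≡ j ! * mult! Ts
  mult!-replicate zero    ≢∅ = ≡.sym (ℕₚ.*-identityˡ _)
  mult!-replicate (suc j) {Ts} ≢∅ = ≡.trans
    (cong₂ (λ a b → suc a * b) (multiplicity-∅ j) (mult!-replicate j ≢∅))
    (≡.sym (ℕₚ.*-assoc (suc j) (j !) (mult! Ts)))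
    where
    multiplicity-∅ : ∀ j → multiplicity ∅ (replicate j ∅ ++ Ts) ≡ j
    multiplicity-∅ zero    = multiplicity-∉ ∅ (All.lookup ≢∅)
    multiplicity-∅ (suc j) = ≡.trans (multiplicity-head ∅ (replicate j ∅ ++ Ts)) (cong suc (multiplicity-∅ j))

  mult!-pad : ∀ n {Ts : List (Block d k)} → All (_≢ ∅) Ts → mult! (pad n Ts) ≡ (n ∸ length Ts) ! * mult! Ts
  mult!-pad n {Ts} = mult!-replicate (n ∸ length Ts)

-- Clearing the denominators of a_ν and b_ν

-- For `S ≢ ∅` no block over `S` is lost when empty restrictions are discarded. Thus the numerators
-- ℓ(ν_S)! of a_ν multiply to m(ν|₀₂)!.
length-fiber : ∀ {k} {S : Block 2 k} → S ≢ ∅ → ∀ Ts →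
               length (filter (λ T → drop₁ T ≟ᴮ S) Ts) ≡ multiplicity S (restrictBlocks 1F Ts)
length-fiber S≢∅ []       = refl
length-fiber {S = S} S≢∅ (T ∷ Ts) with drop₁ T ≟ᴮ S in eq
... | yes refl with drop₁ T ≟ᴮ ∅
...   | yes p = contradiction p S≢∅
...   | no  _ rewrite eq = cong suc (length-fiber S≢∅ Ts)
length-fiber {S = S} S≢∅ (T ∷ Ts) | no ¬p with drop₁ T ≟ᴮ ∅
...   | yes _ = length-fiber S≢∅ Ts
...   | no  _ rewrite eq = length-fiber S≢∅ Ts

module _ {r k : ℕ} (ν : MultisetPartition 3 r k) where

  private
    ℓ₀₂ ℓβ : ℕ
    ℓ₀₂ = length (blocks (ν ∣₀₂))
    ℓβ = length (fiber ν ∅)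
    D : List (Block 2 k)
    D = deduplicate _≟ᴮ_ (blocks (ν ∣₀₂))

  length-blocks : length (blocks ν) ≡ ℓβ + ℓ₀₂
  length-blocks = go (blocks ν)
    where
    go : ∀ Ts → length Ts ≡ length (filter (λ T → drop₁ T ≟ᴮ ∅) Ts) + length (restrictBlocks 1F Ts)
    go []       = refl
    go (T ∷ Ts) with drop₁ T ≟ᴮ ∅
    ... | yes _ = cong suc (go Ts)
    ... | no  _ = ≡.trans (cong suc (go Ts)) (≡.sym (ℕₚ.+-suc _ _))

  a-numerator : a⟨ ν ⟩ ℚ.* fromℕ (Πℕ.fold D (λ S → m! (fiber ν S))) ≡ fromℕ (mult! (blocks (ν ∣₀₂)))
  a-numerator = ≡.trans (go D) (cong fromℕ (≡.trans
    (Πℕ.fold-cong-∈ D λ {S} S∈ → cong _! (length-fiber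
      (All.lookup (non-empty (ν ∣₀₂)) (∈ₚ.∈-deduplicate⁻ _≟ᴮ_ (blocks (ν ∣₀₂)) S∈)) (blocks ν)))
    (m!≡mult! (blocks (ν ∣₀₂)))))
    where
    go : ∀ Ss → foldr ℚ._*_ 1ℚ (map (λ S → length (fiber ν S) ! /m! fiber ν S) Ss) ℚ.*
                fromℕ (Πℕ.fold Ss (λ S → m! (fiber ν S))) ≡
                fromℕ (Πℕ.fold Ss (λ S → length (fiber ν S) !))
    go []       = refl
    go (S ∷ Ss) = begin
      (q ℚ.* A) ℚ.* fromℕ (m! (fiber ν S) * M)
        ≡⟨ cong ((q ℚ.* A) ℚ.*_) (fromℕ-* (m! (fiber ν S)) M) ⟩
      (q ℚ.* A) ℚ.* (fromℕ (m! (fiber ν S)) ℚ.* fromℕ M)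
        ≡⟨ solve 4 (λ q a m n → (q :* a) :* (m :* n) := (q :* m) :* (a :* n)) refl
             q A (fromℕ (m! (fiber ν S))) (fromℕ M) ⟩
      (q ℚ.* fromℕ (m! (fiber ν S))) ℚ.* (A ℚ.* fromℕ M)
        ≡⟨ cong₂ ℚ._*_ (/-*-fromℕ (length (fiber ν S) !) (m! (fiber ν S)) {{m!-nonZero (fiber ν S)}}) (go Ss) ⟩
      fromℕ (length (fiber ν S) !) ℚ.* fromℕ (Πℕ.fold Ss (λ S → length (fiber ν S) !))
        ≡⟨ fromℕ-* (length (fiber ν S) !) _ ⟨
      fromℕ (Πℕ.fold (S ∷ Ss) (λ S → length (fiber ν S) !)) ∎
      where
      open ≡-Reasoning
      open ℚ-Solver.+-*-Solver using (solve; _:=_; _:+_; _:*_; _:-_)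
      q = length (fiber ν S) ! /m! fiber ν S
      A = foldr ℚ._*_ 1ℚ (map (λ S → length (fiber ν S) ! /m! fiber ν S) Ss)
      M = Πℕ.fold Ss (λ S → m! (fiber ν S))

  -- Every block of ν restricts either to a member of `D` or to `∅`, and the fiber over `∅` is β,
  -- whose factor is the denominator of b_ν.
  mult!-blocks : mult! (blocks ν) ≡ m! (fiber ν ∅) * Πℕ.fold D (λ S → m! (fiber ν S))
  mult!-blocks = ≡.trans
    (≡.sym (∏-fibers drop₁ {∅ ∷ D} (Allₚ.¬Any⇒All¬ D ∅∉D ∷ DecUniqueₚ.deduplicate-! _≟ᴮ_ _) (blocks ν) ∈∅∷D))
    (Πℕ.fold-cong (∅ ∷ D) λ S → ≡.sym (m!≡mult! (fiber ν S)))
    where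
    ∅∉D : ∅ ∈ D → _
    ∅∉D ∅∈ = All.lookup (non-empty (ν ∣₀₂)) (∈ₚ.∈-deduplicate⁻ _≟ᴮ_ (blocks (ν ∣₀₂)) ∅∈) refl
    ∈∅∷D : ∀ {T} → T ∈ blocks ν → drop₁ T ∈ ∅ ∷ D
    ∈∅∷D {T} T∈ with drop₁ T ≟ᴮ ∅
    ... | yes p = here p
    ... | no ¬p = there (∈ₚ.∈-deduplicate⁺ _≟ᴮ_ (∈ₚ.∈-filter⁺ (λ S → ¬? (S ≟ᴮ ∅)) (∈ₚ.∈-map⁺ drop₁ T∈) ¬p))

  ab-numerator : ∀ x → (a⟨ ν ⟩ ℚ.* b⟨ ν ⟩ x) ℚ.* fromℕ (mult! (blocks ν)) ≡
                 fromℕ (mult! (blocks (ν ∣₀₂))) ℚ.* falling (x ℚ.- fromℕ ℓ₀₂) ℓβ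
  ab-numerator x = begin
    (a⟨ ν ⟩ ℚ.* (F ℚ.* q)) ℚ.* fromℕ (mult! (blocks ν))
      ≡⟨ cong ((a⟨ ν ⟩ ℚ.* (F ℚ.* q)) ℚ.*_) (≡.trans (cong fromℕ mult!-blocks) (fromℕ-* (m! (fiber ν ∅)) M)) ⟩
    (a⟨ ν ⟩ ℚ.* (F ℚ.* q)) ℚ.* (fromℕ (m! (fiber ν ∅)) ℚ.* fromℕ M)
      ≡⟨ solve 5 (λ a f q m n → (a :* (f :* q)) :* (m :* n) := (a :* n) :* (f :* (q :* m))) refl
           a⟨ ν ⟩ F q (fromℕ (m! (fiber ν ∅))) (fromℕ M) ⟩
    (a⟨ ν ⟩ ℚ.* fromℕ M) ℚ.* (F ℚ.* (q ℚ.* fromℕ (m! (fiber ν ∅))))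
      ≡⟨ cong₂ (λ s t → s ℚ.* (F ℚ.* t)) a-numerator (/-*-fromℕ 1 (m! (fiber ν ∅)) {{m!-nonZero (fiber ν ∅)}}) ⟩
    fromℕ (mult! (blocks (ν ∣₀₂))) ℚ.* (F ℚ.* 1ℚ)
      ≡⟨ cong (fromℕ (mult! (blocks (ν ∣₀₂))) ℚ.*_) (ℚₚ.*-identityʳ F) ⟩
    fromℕ (mult! (blocks (ν ∣₀₂))) ℚ.* F ∎
    where
    open ≡-Reasoning
    open ℚ-Solver.+-*-Solver using (solve; _:=_; _:+_; _:*_; _:-_)
    F = falling (x ℚ.- fromℕ ℓ₀₂) ℓβ
    q = 1 /m! fiber ν ∅
    M = Πℕ.fold D (λ S → m! (fiber ν S))

-- Enumerating the possible rows

tuples-unique : ∀ {A : Set} {xs : List A} → Unique xs → ∀ n → Unique (tuples xs n)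
tuples-unique xs! zero    = [] ∷ []
tuples-unique xs! (suc n) = Uniqueₚ.cartesianProductWith⁺ _∷_ Vecₚ.∷-injective xs! (tuples-unique xs! n)

∈-tuples : ∀ {A : Set} {xs : List A} {n} (v : Vec A n) → (∀ i → lookup v i ∈ xs) → v ∈ tuples xs n
∈-tuples []      h = here refl
∈-tuples (x ∷ v) h = ∈ₚ.∈-cartesianProductWith⁺ _∷_ (h zero) (∈-tuples v (h ∘ suc))

lookup≤sum : ∀ {n} (v : Vec ℕ n) i → lookup v i ≤ Vec.sum v
lookup≤sum (x ∷ v) zero    = ℕₚ.m≤m+n x (Vec.sum v)
lookup≤sum (x ∷ v) (suc i) = ℕₚ.≤-trans (lookup≤sum v i) (ℕₚ.m≤n+m (Vec.sum v) x)

∈⇒≤letters : ∀ {d k} a {T : Block d k} {Ts} → T ∈ Ts → Vec.sum (lookup T a) ≤ letters a Ts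
∈⇒≤letters a {Ts = _ ∷ _} (here refl) = ℕₚ.m≤m+n _ _
∈⇒≤letters a {Ts = _ ∷ _} (there T∈)  = ℕₚ.≤-trans (∈⇒≤letters a T∈) (ℕₚ.m≤n+m _ _)

-- The entries are bounded by r, not the row sum. The surplus rows are harmless: monomials are later
-- selected by degree, and a prescribed shape forces the degree.
boundedRows : ℕ → ∀ k → List (Vec ℕ k)
boundedRows r = tuples (upTo (suc r))

boundedRows-unique : ∀ r k → Unique (boundedRows r k)
boundedRows-unique r = tuples-unique (Uniqueₚ.upTo⁺ (suc r))

∈-boundedRows : ∀ {r k} (v : Vec ℕ k) → Vec.sum v ≤ r → v ∈ boundedRows r k
∈-boundedRows v le = ∈-tuples v λ i → ∈ₚ.∈-upTo⁺ (ℕ.s≤s (ℕₚ.≤-trans (lookup≤sum v i) le))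

sum-∅ : ∀ {d k} (a : Fin d) → Vec.sum (lookup (∅ {d} {k}) a) ≡ 0
sum-∅ {d} {k} a = ≡.trans (cong Vec.sum (Vecₚ.lookup-replicate a (Vec.replicate k 0))) (sum-zeros k)
  where
  sum-zeros : ∀ k → Vec.sum (Vec.replicate k 0) ≡ 0
  sum-zeros zero    = refl
  sum-zeros (suc k) = sum-zeros k

length-rows : ∀ {d n k} (es : Vec (Vec (Vec ℕ k) n) d) → length (rows es) ≡ n
length-rows es = Vecₚ.length-toList (tabulate λ i → Vec.map (λ e → lookup e i) es)

-- The number of middle matrices

-- The last two equations say f = q / p and a = m′ f / m, so the first one, divided by p m, gives c
-- = i (q / p) (m′ / m) = a i. It is applied with p = (n - ℓ(ν))!, q = (n - ℓ(ν|₀₂))!, m = m(ν)! and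
-- m′ = m(ν|₀₂)!.
ratio : ∀ {c i p q m m′ a f} .{{_ : NonZero p}} .{{_ : NonZero m}} → c * (p * m) ≡ i * (q * m′) →
        f ℚ.* fromℕ p ≡ fromℕ q → a ℚ.* fromℕ m ≡ fromℕ m′ ℚ.* f → fromℕ c ≡ a ℚ.* fromℕ i
ratio {c} {i} {p} {q} {m} {m′} {a} {f} {{p≢0}} {{m≢0}} count p*f a*m =
  fromℕ-cancelʳ (p * m) {{ℕₚ.m*n≢0 p m}} _ _ (begin
    fromℕ c ℚ.* fromℕ (p * m)
      ≡⟨ fromℕ-* c (p * m) ⟨
    fromℕ (c * (p * m))
      ≡⟨ cong fromℕ count ⟩
    fromℕ (i * (q * m′))
      ≡⟨ fromℕ-* i (q * m′) ⟩
    fromℕ i ℚ.* fromℕ (q * m′)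
      ≡⟨ cong (fromℕ i ℚ.*_) (≡.trans (fromℕ-* q m′) (cong (ℚ._* fromℕ m′) (≡.sym p*f))) ⟩
    fromℕ i ℚ.* (f ℚ.* fromℕ p ℚ.* fromℕ m′)
      ≡⟨ solve 4 (λ i f p m → i :* (f :* p :* m) := i :* p :* (m :* f)) refl (fromℕ i) f (fromℕ p) (fromℕ m′) ⟩
    fromℕ i ℚ.* fromℕ p ℚ.* (fromℕ m′ ℚ.* f)
      ≡⟨ cong (fromℕ i ℚ.* fromℕ p ℚ.*_) a*m ⟨
    fromℕ i ℚ.* fromℕ p ℚ.* (a ℚ.* fromℕ m)
      ≡⟨ solve 4 (λ i p a m → i :* p :* (a :* m) := a :* i :* (p :* m)) refl (fromℕ i) (fromℕ p) a (fromℕ m) ⟩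
    a ℚ.* fromℕ i ℚ.* (fromℕ p ℚ.* fromℕ m)
      ≡⟨ cong (a ℚ.* fromℕ i ℚ.*_) (fromℕ-* p m) ⟨
    a ℚ.* fromℕ i ℚ.* fromℕ (p * m) ∎)
  where
  open ≡-Reasoning
  open ℚ-Solver.+-*-Solver using (solve; _:=_; _:*_)

vanish : ∀ {m m′ a f} .{{_ : NonZero m}} → a ℚ.* fromℕ m ≡ fromℕ m′ ℚ.* f → f ≡ 0ℚ → a ≡ 0ℚ
vanish {m} {m′} {a} a*m refl = fromℕ-cancelʳ m a 0ℚ
  (≡.trans a*m (≡.trans (ℚₚ.*-zeroʳ (fromℕ m′)) (≡.sym (ℚₚ.*-zeroˡ (fromℕ m)))))

module _ {r k n : ℕ} (ν : MultisetPartition 3 r k) (e g : Vec (Vec ℕ k) n) where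

  private
    _↭?_ : ∀ {d} → (Ts Us : List (Block d k)) → Dec (Ts ↭ Us)
    _↭?_ = ↭-dec _≟ᴮ_
    N = blocks ν
    ρ = blocks (ν ∣₀₂)
    N≢∅ = non-empty ν
    ρ≢∅ = non-empty (ν ∣₀₂)
    R = rows (e ∷ g ∷ [])
    Ys = boundedRows r k
    M = mult! N
    M′ = mult! ρ
    ab = a⟨ ν ⟩ ℚ.* b⟨ ν ⟩ (fromℕ n)
    I = 𝟙 (ρ ↭? nonEmpty R)
    F = falling (fromℕ n ℚ.- fromℕ (length ρ)) (length (fiber ν ∅))
    C = Σℕ.fold (tuples Ys n) (λ x → 𝟙 (nonEmpty (rows (e ∷ x ∷ g ∷ [])) ↭? N))

    ρ≤N : length ρ ≤ length N
    ρ≤N = subst (length ρ ≤_) (≡.sym (length-blocks ν)) (ℕₚ.m≤n+m (length ρ) (length (fiber ν ∅)))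

    ∈Ys : ∀ j {T} → T ∈ replicate j ∅ ++ N → lookup T 1F ∈ Ys
    ∈Ys j {T} T∈ with ∈ₚ.∈-++⁻ (replicate j ∅) T∈
    ... | inj₁ T∈∅s = ∈-boundedRows _ (subst (_≤ r) (≡.sym (≡.trans
            (cong (λ U → Vec.sum (lookup U 1F)) (All.lookup (Allₚ.replicate⁺ {P = _≡ ∅} j refl) T∈∅s))
            (sum-∅ {3} {k} 1F))) ℕ.z≤n)
    ... | inj₂ T∈N  = ∈-boundedRows _ (subst (_ ≤_) (content ν 1F) (∈⇒≤letters 1F T∈N))

    -- Under restriction the blocks of β become empty and join the padding. The restricted list
    -- therefore has n - ℓ(ν|₀₂) empty blocks, the source of that factorial.
    I-pad : length N ≤ n → 𝟙 (map drop₁ (pad n N) ↭? R) * mult! R ≡ I * ((n ∸ length ρ) ! * M′)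
    I-pad N≤n = ≡.trans (cong (_* mult! R) (𝟙-cong (map drop₁ (pad n N) ↭? R) (ρ ↭? nonEmpty R) to from)) 
      (reduce (ρ ↭? nonEmpty R))
      where
      nonEmpty-drop₁ : nonEmpty (map drop₁ (pad n N)) ≡ ρ
      nonEmpty-drop₁ = ≡.trans (cong nonEmpty (≡.trans (Listₚ.map-++ drop₁ (replicate (n ∸ length N) ∅) N)
        (cong (_++ map drop₁ N) (Listₚ.map-replicate drop₁ (n ∸ length N) ∅))))
        (nonEmpty-replicate (n ∸ length N) (map drop₁ N))
      to : map drop₁ (pad n N) ↭ R → ρ ↭ nonEmpty R
      to p = subst (_↭ nonEmpty R) nonEmpty-drop₁ (nonEmpty-↭⁺ p)
      from : ρ ↭ nonEmpty R → map drop₁ (pad n N) ↭ R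
      from p = nonEmpty-↭⁻ {Ts = map drop₁ (pad n N)} {Us = R}
        (≡.trans (Listₚ.length-map drop₁ (pad n N))
          (≡.trans (length-pad N N≤n) (≡.sym (length-rows (e ∷ g ∷ [])))))
        (subst (_↭ nonEmpty R) (≡.sym nonEmpty-drop₁) p)
      reduce : (d : Dec (ρ ↭ nonEmpty R)) → 𝟙 d * mult! R ≡ 𝟙 d * ((n ∸ length ρ) ! * M′)
      reduce (no  _) = refl
      reduce (yes p) = cong (1 *_) (≡.trans (≡.sym (mult!-↭ (nonEmpty-↭⁻ {Ts = pad n ρ} {Us = R}
        (≡.trans (length-pad ρ (ℕₚ.≤-trans ρ≤N N≤n)) (≡.sym (length-rows (e ∷ g ∷ []))))
        (subst (_↭ nonEmpty R) (≡.sym (nonEmpty-pad n ρ≢∅)) p)))) (mult!-pad n ρ≢∅))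

    count-pad : length N ≤ n → C * ((n ∸ length N) ! * M) ≡ I * ((n ∸ length ρ) ! * M′)
    count-pad N≤n = begin
      C * ((n ∸ length N) ! * M)
        ≡⟨ cong₂ _*_ (Σℕ.fold-cong (tuples Ys n) λ x →
             𝟙-cong (nonEmpty (rows (e ∷ x ∷ g ∷ [])) ↭? N) (rows (e ∷ x ∷ g ∷ []) ↭? pad n N)
               (λ p → nonEmpty-↭⁻ (≡.trans (length-rows (e ∷ x ∷ g ∷ [])) (≡.sym (length-pad N N≤n)))
                        (subst (_ ↭_) (≡.sym (nonEmpty-pad n N≢∅)) p))
               (λ p → subst (_ ↭_) (nonEmpty-pad n N≢∅) (nonEmpty-↭⁺ p)))
             (≡.sym (mult!-pad n N≢∅)) ⟩
      Σℕ.fold (tuples Ys n) (λ x → 𝟙 (rows (e ∷ x ∷ g ∷ []) ↭? pad n N)) * mult! (pad n N)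
        ≡⟨ count-fillings (boundedRows-unique r k) e g (pad n N) (∈Ys (n ∸ length N)) ⟩
      𝟙 (map drop₁ (pad n N) ↭? R) * mult! R
        ≡⟨ I-pad N≤n ⟩
      I * ((n ∸ length ρ) ! * M′) ∎
      where open ≡-Reasoning

    falling-pad : length N ≤ n → F ℚ.* fromℕ ((n ∸ length N) !) ≡ fromℕ ((n ∸ length ρ) !)
    falling-pad N≤n = begin
      F ℚ.* fromℕ ((n ∸ length N) !)
        ≡⟨ cong₂ (λ x m → falling x s ℚ.* fromℕ (m !)) (fromℕ-∸ ρ≤n) n∸N ⟩
      falling (fromℕ (n ∸ length ρ)) s ℚ.* fromℕ ((n ∸ length ρ ∸ s) !)
        ≡⟨ falling-≤ s≤ ⟩
      fromℕ ((n ∸ length ρ) !) ∎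
      where
      open ≡-Reasoning
      s = length (fiber ν ∅)
      ρ≤n = ℕₚ.≤-trans ρ≤N N≤n
      N≡ : length N ≡ length ρ + s
      N≡ = ≡.trans (length-blocks ν) (ℕₚ.+-comm s (length ρ))
      n∸N : n ∸ length N ≡ n ∸ length ρ ∸ s
      n∸N = ≡.trans (cong (n ∸_) N≡) (≡.sym (ℕₚ.∸-+-assoc n (length ρ) s))
      s≤ : s ≤ n ∸ length ρ
      s≤ = ℕₚ.m+n≤o⇒m≤o∸n s (subst (_≤ n) (length-blocks ν) N≤n)

    count-≤ : length N ≤ n → fromℕ C ≡ ab ℚ.* fromℕ I
    count-≤ N≤n = ratio {C} {I} {(n ∸ length N) !} {(n ∸ length ρ) !} {M} {M′} {ab} {F}
      {{(n ∸ length N) ℕₚ.!≢0}} {{mult!-nonZero N}}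
      (count-pad N≤n) (falling-pad N≤n) (ab-numerator ν (fromℕ n))

    -- A shape has at most n blocks, so no middle matrix gives ν. If (e, g) has shape ν|₀₂, then
    -- ℓ(ν|₀₂) ≤ n < ℓ(ν|₀₂) + ℓ(β) and the falling factorial vanishes; otherwise the indicator
    -- does.
    count-> : n < length N → fromℕ C ≡ ab ℚ.* fromℕ I
    count-> n<N = ≡.trans (cong fromℕ C≡0) (≡.sym (ab*I≡0 (ρ ↭? nonEmpty R)))
      where
      length-nonEmpty : ∀ {d} (es : Vec (Vec (Vec ℕ k) n) d) → length (nonEmpty (rows es)) ≤ n
      length-nonEmpty es = subst (length (nonEmpty (rows es)) ≤_) (length-rows es)
        (Listₚ.length-filter (λ T → ¬? (T ≟ᴮ ∅)) (rows es))
      C≡0 : C ≡ 0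
      C≡0 = ≡.trans (Σℕ.fold-cong (tuples Ys n) λ x →
        𝟙-cong (nonEmpty (rows (e ∷ x ∷ g ∷ [])) ↭? N) (no λ ())
          (λ p → ℕₚ.<⇒≱ n<N (subst (_≤ n) (↭ₚ.↭-length p) (length-nonEmpty (e ∷ x ∷ g ∷ []))))
          λ ()) (Σℕ.fold-ε (tuples Ys n))
      ab≡0 : length ρ ≤ n → ab ≡ 0ℚ
      ab≡0 ρ≤n = vanish {M} {M′} {ab} {F} {{mult!-nonZero N}} (ab-numerator ν (fromℕ n))
        (≡.trans (cong (λ x → falling x (length (fiber ν ∅))) (fromℕ-∸ ρ≤n)) (falling-> n∸ρ<))
        where
        n∸ρ< : n ∸ length ρ < length (fiber ν ∅)
        n∸ρ< = ℕₚ.m<n+o⇒m∸n<o n (length ρ) {{ℕ.>-nonZero fiber>0}} n<ρ+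
          where
          n<ρ+ : n < length ρ + length (fiber ν ∅)
          n<ρ+ = subst (n <_) (≡.trans (length-blocks ν) (ℕₚ.+-comm (length (fiber ν ∅)) (length ρ))) n<N
          fiber>0 : 0 < length (fiber ν ∅)
          fiber>0 = ℕₚ.+-cancelˡ-< (length ρ) 0 _
            (ℕₚ.≤-<-trans (subst (_≤ n) (≡.sym (ℕₚ.+-identityʳ _)) ρ≤n) n<ρ+)
      ab*I≡0 : (d : Dec (ρ ↭ nonEmpty R)) → ab ℚ.* fromℕ (𝟙 d) ≡ 0ℚ
      ab*I≡0 (no  _) = ℚₚ.*-zeroʳ ab
      ab*I≡0 (yes p) = ≡.trans
        -- The bound ℓ(ν|₀₂) ≤ n is available only here, since it comes from (e, g) having that
        -- shape.
        (cong (ℚ._* 1ℚ) (ab≡0 (subst (_≤ n) (≡.sym (↭ₚ.↭-length p)) (length-nonEmpty (e ∷ g ∷ [])))))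
        (ℚₚ.*-zeroˡ 1ℚ)

  count-middles :
    fromℕ (Σℕ.fold (tuples (boundedRows r k) n)
            (λ x → 𝟙 (nonEmpty (rows (e ∷ x ∷ g ∷ [])) ↭? blocks ν))) ≡
    (a⟨ ν ⟩ ℚ.* b⟨ ν ⟩ (fromℕ n)) ℚ.* fromℕ (𝟙 (blocks (ν ∣₀₂) ↭? nonEmpty (rows (e ∷ g ∷ []))))
  count-middles = [ count-≤ , count-> ]′ (ℕₚ.≤-<-connex (length (blocks ν)) n)

-- Shapes of tuples of monomials

module Sumℕ = CommutativeMonoidSum ℕₚ.+-0-commutativeMonoid

letters-nonEmpty : ∀ {d k} (a : Fin d) (Ts : List (Block d k)) → letters a (nonEmpty Ts) ≡ letters a Ts
letters-nonEmpty a []       = refl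
letters-nonEmpty a (T ∷ Ts) with T ≟ᴮ ∅
... | yes refl = ≡.trans (letters-nonEmpty a Ts) (cong (_+ letters a Ts) (≡.sym (sum-∅ a)))
... | no  _    = cong (Vec.sum (lookup T a) +_) (letters-nonEmpty a Ts)

letters-tabulate : ∀ {d k n} a (f : Fin n → Block d k) →
                   letters a (toList (tabulate f)) ≡ Sumℕ.sum (λ i → Vec.sum (lookup (f i) a))
letters-tabulate {n = zero}  a f = refl
letters-tabulate {n = suc n} a f = cong (Vec.sum (lookup (f zero) a) +_) (letters-tabulate a (f ∘ suc))

letters-rows : ∀ {d n k} (a : Fin d) (es : Vec (Vec (Vec ℕ k) n) d) →
               letters a (nonEmpty (rows es)) ≡ degree (lookup es a)
letters-rows a es = ≡.trans (letters-nonEmpty a (rows es)) (≡.trans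
  (letters-tabulate a λ i → Vec.map (λ e → lookup e i) es)
  (Sumℕ.sum-cong-≗ λ i → cong Vec.sum (Vecₚ.lookup-map a (λ e → lookup e i) es)))

removeAt-map : ∀ {A B : Set} {n} (f : A → B) (v : Vec A (suc n)) a →
               removeAt (Vec.map f v) a ≡ Vec.map f (removeAt v a)
removeAt-map f (x ∷ v)     zero    = refl
removeAt-map f (x ∷ y ∷ v) (suc a) = cong (f x ∷_) (removeAt-map f (y ∷ v) a)

removeAt-replicate : ∀ {A : Set} {n} (x : A) (a : Fin (suc n)) →
                     removeAt (Vec.replicate (suc n) x) a ≡ Vec.replicate n x
removeAt-replicate             x zero    = refl
removeAt-replicate {n = suc n} x (suc a) = cong (x ∷_) (removeAt-replicate x a)

restrictBlocks-nonEmpty : ∀ {d k} (a : Fin (suc d)) (Ts : List (Block (suc d) k)) →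
                          restrictBlocks a (nonEmpty Ts) ≡ restrictBlocks a Ts
restrictBlocks-nonEmpty a []       = refl
restrictBlocks-nonEmpty {d} {k} a (T ∷ Ts) with T ≟ᴮ ∅
... | yes refl = ≡.trans (restrictBlocks-nonEmpty a Ts) (≡.sym
  (Listₚ.filter-reject (λ T → ¬? (T ≟ᴮ ∅)) (λ ≢∅ → ≢∅ (removeAt-replicate _ a))))
... | no  _    with removeAt T a ≟ᴮ ∅
...   | yes _ = restrictBlocks-nonEmpty a Ts
...   | no  _ = cong (removeAt T a ∷_) (restrictBlocks-nonEmpty a Ts)

restrictBlocks-rows : ∀ {d n k} (a : Fin (suc d)) (es : Vec (Vec (Vec ℕ k) n) (suc d)) →
                      restrictBlocks a (nonEmpty (rows es)) ≡ nonEmpty (rows (removeAt es a))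
restrictBlocks-rows a es = ≡.trans (restrictBlocks-nonEmpty a (rows es)) (cong nonEmpty
  (≡.trans (≡.sym (Vecₚ.toList-map (λ T → removeAt T a) _)) (cong toList
    (≡.trans (≡.sym (Vecₚ.tabulate-∘ (λ T → removeAt T a) _))
      (Vecₚ.tabulate-cong λ i → removeAt-map (λ e → lookup e i) es a)))))

-- Permutations of rows and orbits of tuples

module _ {A : Set} where

  private
    module ++ = CommutativeMonoidSum (↭ₚ.++-commutativeMonoid {A = A})

  -- Lists under `_++_` up to `_↭_` form a commutative monoid in which a list is the sum of its
  -- singletons; invariance of finite sums under permutation of the indices then applies.
  toList-tabulate-permute : ∀ {n} (f : Fin n → A) (σ : Permutation′ n) →
                            toList (tabulate (f ∘ (σ ⟨$⟩ʳ_))) ↭ toList (tabulate f)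
  toList-tabulate-permute f σ = ↭-trans (↭-reflexive (as-sum (f ∘ (σ ⟨$⟩ʳ_)))) (↭-trans
    (↭-sym (++.sum-permute (λ i → f i ∷ []) σ)) (↭-reflexive (≡.sym (as-sum f))))
    where
    as-sum : ∀ {n} (f : Fin n → A) → toList (tabulate f) ≡ ++.sum (λ i → f i ∷ [])
    as-sum {zero}  f = refl
    as-sum {suc n} f = cong (f zero ∷_) (as-sum (f ∘ suc))

  lookup-toList : ∀ {n} (v : Vec A n) i → List.lookup (toList v) i ≡ lookup v (cast (Vecₚ.length-toList v) i)
  lookup-toList (x ∷ v) zero    = refl
  lookup-toList (x ∷ v) (suc i) = lookup-toList v i

  -- A derivation of `_↭_` carries a bijection of list positions; casts at both ends turn it into a
  -- permutation of `Fin n`.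
  ↭⇒permutation : ∀ {n} (v w : Vec A n) → toList v ↭ toList w →
                  ∃ λ (σ : Permutation′ n) → ∀ i → lookup w i ≡ lookup v (σ ⟨$⟩ˡ i)
  ↭⇒permutation v w p = σ , λ i → begin
    lookup w i
      ≡⟨ cong (lookup w) (Perm.inverseʳ σ) ⟨
    lookup w (σ ⟨$⟩ʳ (σ ⟨$⟩ˡ i))
      ≡⟨ lookup-toList w (indices ⟨$⟩ʳ (c ⟨$⟩ˡ (σ ⟨$⟩ˡ i))) ⟨
    List.lookup (toList w) (indices ⟨$⟩ʳ (c ⟨$⟩ˡ (σ ⟨$⟩ˡ i)))
      ≡⟨ Permutationₛₚ.onIndices-lookup (≡.setoid A) (↭⇒↭ₛ p) _ ⟨
    List.lookup (toList v) (c ⟨$⟩ˡ (σ ⟨$⟩ˡ i))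
      ≡⟨ lookup-toList v _ ⟩
    lookup v (c ⟨$⟩ʳ (c ⟨$⟩ˡ (σ ⟨$⟩ˡ i)))
      ≡⟨ cong (lookup v) (Perm.inverseʳ c) ⟩
    lookup v (σ ⟨$⟩ˡ i) ∎
    where
    open ≡-Reasoning
    c = Perm.cast-id (Vecₚ.length-toList v)
    indices = onIndices (↭⇒↭ₛ p)
    σ = flip c ∘ₚ (indices ∘ₚ Perm.cast-id (Vecₚ.length-toList w))

rows-permute : ∀ {d n k} (σ : Permutation′ n) (es : Vec (Vec (Vec ℕ k) n) d) →
               rows (Vec.map (permuteRows σ) es) ↭ rows es
rows-permute σ es = ↭-trans (↭-reflexive (cong toList (Vecₚ.tabulate-cong λ i →
    ≡.trans (≡.sym (Vecₚ.map-∘ (λ e → lookup e i) (permuteRows σ) es))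
      (Vecₚ.map-cong (λ e → Vecₚ.lookup∘tabulate _ i) es))))
  (toList-tabulate-permute (λ i → Vec.map (λ e → lookup e i) es) (flip σ))

-- A block holds the i-th rows of all d matrices at once, so matching blocks yields a single σ that
-- serves all the matrices simultaneously.
rows-↭⇒permutation : ∀ {d n k} (es es′ : Vec (Vec (Vec ℕ k) n) d) → rows es ↭ rows es′ →
                     ∃ λ (σ : Permutation′ n) → ∀ a → lookup es′ a ≡ permuteRows σ (lookup es a)
rows-↭⇒permutation es es′ p = let σ , eq = ↭⇒permutation _ _ p in σ , λ a →
  ≡.trans (≡.sym (Vecₚ.tabulate∘lookup (lookup es′ a))) (Vecₚ.tabulate-cong λ i → begin
    lookup (lookup es′ a) i
      ≡⟨ entry es′ a i ⟨
    lookup (lookup (tabulate (row es′)) i) a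
      ≡⟨ cong (λ T → lookup T a) (eq i) ⟩
    lookup (lookup (tabulate (row es)) (σ ⟨$⟩ˡ i)) a
      ≡⟨ entry es a (σ ⟨$⟩ˡ i) ⟩
    lookup (lookup es a) (σ ⟨$⟩ˡ i) ∎)
  where
  open ≡-Reasoning
  row : ∀ {d n k} → Vec (Vec (Vec ℕ k) n) d → Fin n → Block d k
  row es i = Vec.map (λ e → lookup e i) es
  entry : ∀ {d n k} (es : Vec (Vec (Vec ℕ k) n) d) a i →
          lookup (lookup (tabulate (row es)) i) a ≡ lookup (lookup es a) i
  entry es a i = ≡.trans (cong (λ T → lookup T a) (Vecₚ.lookup∘tabulate (row es) i))
                   (Vecₚ.lookup-map a (λ e → lookup e i) es)

-- The transpose, inverse to `rows` in the direction needed to realise a given list of blocks by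
-- matrices.
columns : ∀ {d k} (Ts : List (Block d k)) → Vec (Vec (Vec ℕ k) (length Ts)) d
columns Ts = tabulate λ a → Vec.map (λ T → lookup T a) (Vec.fromList Ts)

rows-columns : ∀ {d k} (Ts : List (Block d k)) → rows (columns Ts) ≡ Ts
rows-columns Ts = ≡.trans (cong toList (≡.trans (Vecₚ.tabulate-cong row-columns)
  (Vecₚ.tabulate∘lookup (Vec.fromList Ts)))) (Vecₚ.toList∘fromList Ts)
  where
  row-columns : ∀ i → Vec.map (λ e → lookup e i) (columns Ts) ≡ lookup (Vec.fromList Ts) i
  row-columns i = ≡.trans (≡.sym (Vecₚ.tabulate-∘ (λ e → lookup e i) _)) (≡.trans
    (Vecₚ.tabulate-cong λ a → Vecₚ.lookup-map i (λ T → lookup T a) (Vec.fromList Ts))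
    (Vecₚ.tabulate∘lookup (lookup (Vec.fromList Ts) i)))

-- Each non-empty block uses at least one letter. This is where the bound 2r on the number of blocks
-- of a partition in Π comes from.
length≤letters : ∀ {k} {Ts : List (Block 2 k)} → All (_≢ ∅) Ts → length Ts ≤ letters 0F Ts + letters 1F Ts
length≤letters []                            = ℕ.z≤n
length≤letters {Ts = (a ∷ b ∷ []) ∷ Ts} (≢∅ ∷ ps) = begin
  1 + length Ts
    ≤⟨ ℕₚ.+-mono-≤ (ℕₚ.n≢0⇒n>0 (λ eq → ≢∅ (cong₂ (λ a b → a ∷ b ∷ [])
         (sum≡0 a (ℕₚ.m+n≡0⇒m≡0 (Vec.sum a) eq)) (sum≡0 b (ℕₚ.m+n≡0⇒n≡0 (Vec.sum a) eq)))))
       (length≤letters ps) ⟩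
  (Vec.sum a + Vec.sum b) + (letters 0F Ts + letters 1F Ts)
    ≡⟨ interchange (Vec.sum a) (Vec.sum b) (letters 0F Ts) (letters 1F Ts) ⟩
  (Vec.sum a + letters 0F Ts) + (Vec.sum b + letters 1F Ts) ∎
  where
  open ℕₚ.≤-Reasoning
  open CommutativeSemigroupProperties ℕₚ.+-commutativeSemigroup using (interchange)
  sum≡0 : ∀ {k} (v : Vec ℕ k) → Vec.sum v ≡ 0 → v ≡ Vec.replicate k 0
  sum≡0 []         _  = refl
  sum≡0 (zero ∷ v) eq = cong (0 ∷_) (sum≡0 v eq)

-- Monomials and their shapes

module _ {n k r : ℕ} where

  monomial-≡ : {m m′ : Monomial n k r} → exponents m ≡ exponents m′ → m ≡ m′
  monomial-≡ {mkMonomial e p} {mkMonomial .e q} refl = cong (mkMonomial e) (ℕₚ.≡-irrelevant p q)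

  infix 4 _≟ᴹ_
  _≟ᴹ_ : DecidableEquality (Monomial n k r)
  m ≟ᴹ m′ = map′ monomial-≡ (cong exponents) (Vecₚ.≡-dec (Vecₚ.≡-dec ℕₚ._≟_) (exponents m) (exponents m′))

  withDegree : List (Vec (Vec ℕ k) n) → List (Monomial n k r)
  withDegree []       = []
  withDegree (e ∷ es) with degree e ℕₚ.≟ r
  ... | yes p = mkMonomial e p ∷ withDegree es
  ... | no  _ = withDegree es

  -- `withDegree` must keep the degree proofs and so is no plain filter; after forgetting them it is
  -- one, and uniqueness, membership and sums are transferred along this equation.
  map-exponents : ∀ es → map exponents (withDegree es) ≡ filter (λ e → degree e ℕₚ.≟ r) es
  map-exponents []       = refl
  map-exponents (e ∷ es) with degree e ℕₚ.≟ r
  ... | yes p = ≡.trans (cong (e ∷_) (map-exponents es)) (≡.sym (Listₚ.filter-accept (λ e → degree e ℕₚ.≟ r) p))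
  ... | no ¬p = ≡.trans (map-exponents es) (≡.sym (Listₚ.filter-reject (λ e → degree e ℕₚ.≟ r) ¬p))

  monomials : List (Monomial n k r)
  monomials = withDegree (tuples (boundedRows r k) n)

  monomials-unique : Unique monomials
  monomials-unique = Uniqueₚ.map⁻ (subst Unique (≡.sym (map-exponents (tuples (boundedRows r k) n)))
    (Uniqueₚ.filter⁺ (λ e → degree e ℕₚ.≟ r) (tuples-unique (boundedRows-unique r k) n)))

  ∈-monomials : ∀ m → m ∈ monomials
  ∈-monomials m with ∈ₚ.∈-map⁻ exponents
    (subst (exponents m ∈_) (≡.sym (map-exponents (tuples (boundedRows r k) n)))
    (∈ₚ.∈-filter⁺ (λ e → degree e ℕₚ.≟ r) (∈-tuples (exponents m) λ i → ∈-boundedRows _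
      (subst (_ ≤_) (degree≡r m) (row≤sum (λ i → Vec.sum (lookup (exponents m) i)) i))) (degree≡r m)))
    where
    row≤sum : ∀ {n} (f : Fin n → ℕ) i → f i ≤ Sumℕ.sum f
    row≤sum f zero    = ℕₚ.m≤m+n _ _
    row≤sum f (suc i) = ℕₚ.≤-trans (row≤sum (f ∘ suc) i) (ℕₚ.m≤n+m _ _)
  ... | m′ , m′∈ , eq = subst (_∈ monomials) (≡.sym (monomial-≡ eq)) m′∈

  shape : ∀ {d} → Vec (Monomial n k r) d → MultisetPartition d r k
  shape ms .blocks    = nonEmpty (rows (Vec.map exponents ms))
  shape ms .non-empty = Allₚ.all-filter (λ T → ¬? (T ≟ᴮ ∅)) (rows (Vec.map exponents ms))
  shape ms .content a = ≡.trans (letters-rows a (Vec.map exponents ms))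
    (≡.trans (cong degree (Vecₚ.lookup-map a exponents ms)) (degree≡r (lookup ms a)))

  -- Deleting an alphabet amounts to forgetting a monomial. For (e, m, g) the restrictions to 01, 12
  -- and 02 are thus the shapes of (e, m), (m, g) and (e, g).
  restrict-shape : ∀ {d} a (ms : Vec (Monomial n k r) (suc d)) →
                   blocks (restrict a (shape ms)) ≡ blocks (shape (removeAt ms a))
  restrict-shape a ms = ≡.trans (restrictBlocks-rows a (Vec.map exponents ms))
    (cong (nonEmpty ∘ rows) (removeAt-map exponents ms a))

  shape-permute : ∀ {d} (σ : Permutation′ n) (ms : Vec (Monomial n k r) d) →
                  shape (Vec.map (σ ·_) ms) ≈ᴾ shape ms
  shape-permute σ ms = nonEmpty-↭⁺ (↭-trans
    (↭-reflexive (cong rows (≡.trans (≡.sym (Vecₚ.map-∘ exponents (σ ·_) ms))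
      (Vecₚ.map-∘ (permuteRows σ) exponents ms))))
    (rows-permute σ (Vec.map exponents ms)))

  shape-≈⇒permutation : ∀ {d} (ms ms′ : Vec (Monomial n k r) d) → shape ms ≈ᴾ shape ms′ →
                        ∃ λ (σ : Permutation′ n) → ∀ a → lookup ms′ a ≡ σ · lookup ms a
  shape-≈⇒permutation ms ms′ p = let σ , eq = rows-↭⇒permutation es es′ rows↭ in σ , λ a → monomial-≡
    (≡.trans (≡.sym (Vecₚ.lookup-map a exponents ms′))
      (≡.trans (eq a) (cong (permuteRows σ) (Vecₚ.lookup-map a exponents ms))))
    where
    es = Vec.map exponents ms
    es′ = Vec.map exponents ms′
    rows↭ : rows es ↭ rows es′
    rows↭ = nonEmpty-↭⁻ (≡.trans (length-rows es) (≡.sym (length-rows es′))) p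

  count-shapes : (ν : MultisetPartition 3 r k) (e g : Monomial n k r) →
    fromℕ (Σℕ.fold monomials (λ m → 𝟙 (shape (e ∷ m ∷ g ∷ []) ≟ᴾ ν))) ≡
    (a⟨ ν ⟩ ℚ.* b⟨ ν ⟩ (fromℕ n)) ℚ.* fromℕ (𝟙 (ν ∣₀₂ ≟ᴾ shape (e ∷ g ∷ [])))
  count-shapes ν e g = ≡.trans (cong fromℕ (begin
    Σℕ.fold monomials (h ∘ exponents)
      ≡⟨ Σℕ.fold-map exponents monomials h ⟨
    Σℕ.fold (map exponents monomials) h
      ≡⟨ cong (λ es → Σℕ.fold es h) (map-exponents xs) ⟩
    Σℕ.fold (filter (λ x → degree x ℕₚ.≟ r) xs) h
      ≡⟨ Σℕ.fold-filter (λ x → degree x ℕₚ.≟ r) xs h ⟩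
    Σℕ.fold xs (λ x → if does (degree x ℕₚ.≟ r) then h x else 0)
      ≡⟨ Σℕ.fold-cong xs (λ x → drop-degree x (degree x ℕₚ.≟ r) (shape? x)) ⟩
    Σℕ.fold xs h ∎)) (count-middles ν (exponents e) (exponents g))
    where
    open ≡-Reasoning
    xs = tuples (boundedRows r k) n
    triple : Vec (Vec ℕ k) n → Vec (Vec (Vec ℕ k) n) 3
    triple x = exponents e ∷ x ∷ exponents g ∷ []
    shape? : ∀ x → Dec (nonEmpty (rows (triple x)) ↭ blocks ν)
    shape? x = ↭-dec _≟ᴮ_ (nonEmpty (rows (triple x))) (blocks ν)
    h : Vec (Vec ℕ k) n → ℕ
    h x = 𝟙 (shape? x)
    letters-↭ : ∀ {d k} (a : Fin d) {Ts Us : List (Block d k)} → Ts ↭ Us → letters a Ts ≡ letters a Us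
    letters-↭ a p = sum-↭ (↭ₚ.map⁺ (λ T → Vec.sum (lookup T a)) p)
    -- The degree of the middle matrix is the number of singly barred letters of its triple's shape;
    -- if the shape is ν this number is r, so the restriction on degrees excludes nothing.
    drop-degree : ∀ x (deg? : Dec (degree x ≡ r)) (s? : Dec (nonEmpty (rows (triple x)) ↭ blocks ν)) →
                  (if does deg? then 𝟙 s? else 0) ≡ 𝟙 s?
    drop-degree x (yes _) _       = refl
    drop-degree x (no  _) (no _)  = refl
    drop-degree x (no ¬p) (yes q) = contradiction
      (≡.trans (≡.sym (letters-rows 1F (triple x))) (≡.trans (letters-↭ 1F q) (content ν 1F))) ¬p

  module _ (n≥2r : n ≥ 2 * r) where

    shape-surjective : ∀ π → ∃ λ ms → blocks (shape ms) ≡ blocks π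
    shape-surjective π = go (columns padded)
      (≡.trans (cong nonEmpty (rows-columns padded)) (nonEmpty-pad n (non-empty π)))
      (length-pad (blocks π) (ℕₚ.≤-trans |π|≤2r n≥2r))
      where
      padded = pad n (blocks π)
      |π|≤2r : length (blocks π) ≤ 2 * r
      |π|≤2r = ℕₚ.≤-trans (length≤letters (non-empty π)) (ℕₚ.≤-reflexive
        (cong₂ _+_ (content π 0F) (≡.trans (content π 1F) (≡.sym (ℕₚ.+-identityʳ r)))))
      -- The columns have `length padded` rows, which equals n only propositionally; with the row
      -- count abstracted to l the equation can be matched against `refl`.
      go : ∀ {l} (es : Vec (Vec (Vec ℕ k) l) 2) → nonEmpty (rows es) ≡ blocks π → l ≡ n →
           ∃ λ (ms : Vec (Monomial n k r) 2) → blocks (shape ms) ≡ blocks π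
      go (e ∷ m ∷ []) eq refl = mkMonomial e (deg 0F) ∷ mkMonomial m (deg 1F) ∷ [] , eq
        where
        deg : ∀ a → degree (lookup (e ∷ m ∷ []) a) ≡ r
        deg a = ≡.trans (≡.sym (letters-rows a (e ∷ m ∷ []))) (≡.trans (cong (letters a) eq) (content π a))

restrict-cong : ∀ {d r k} a {ν ν′ : MultisetPartition (suc d) r k} → ν ≈ᴾ ν′ → restrict a ν ≈ᴾ restrict a ν′
restrict-cong a p = nonEmpty-↭⁺ (↭ₚ.map⁺ _ p)

·-inverse : ∀ {n k r} (σ τ : Permutation′ n) → (∀ i → σ ⟨$⟩ˡ (τ ⟨$⟩ˡ i) ≡ i) →
            (m : Monomial n k r) → τ · (σ · m) ≡ m
·-inverse σ τ στ m = monomial-≡ (≡.trans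
  (Vecₚ.tabulate-cong λ i → ≡.trans (Vecₚ.lookup∘tabulate _ (τ ⟨$⟩ˡ i)) (cong (lookup (exponents m)) (στ i)))
  (Vecₚ.tabulate∘lookup (exponents m)))

-- The isomorphism over a ring receiving the rationals

module OverRing
  (𝕂 : CommutativeRing 0ℓ 0ℓ) (fromℚ : ℚ → CommutativeRing.Carrier 𝕂)
  (isHomomorphism : IsSemiringHomomorphism ℚ.+-*-rawSemiring
                       (Semiring.rawSemiring (CommutativeRing.semiring 𝕂)) fromℚ)
  where

  private
    module K = CommutativeRing 𝕂
    module O = Over 𝕂 fromℚ
    module ℚ→K = IsSemiringHomomorphism isHomomorphism

  module ΣK = ListFold K.+-commutativeMonoid

  open K using (_≈_; 0#; 1#) renaming (_+_ to _+ᴷ_; _*_ to _*ᴷ_)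
  open import Relation.Binary.Reasoning.Setoid K.setoid
  open RingProperties K.ring using (-0#≈0#; -‿distribʳ-*; -‿+-comm)
  open CommutativeSemigroupProperties K.*-commutativeSemigroup using (x∙yz≈y∙xz)
  open Func using () renaming (to to _at_)

  *-fold : ∀ {A : Set} c (xs : List A) f → c *ᴷ ΣK.fold xs f ≈ ΣK.fold xs (λ x → c *ᴷ f x)
  *-fold c xs f = ΣK.fold-homo _+ᴷ_ 0# (c *ᴷ_) (K.zeroʳ c) (K.distribˡ c) xs f

  neg-fold : ∀ {A : Set} (xs : List A) f → ΣK.fold xs (λ x → K.- f x) ≈ K.- ΣK.fold xs f
  neg-fold xs f = K.sym (ΣK.fold-homo _+ᴷ_ 0# K.-_ -0#≈0# (λ x y → K.sym (-‿+-comm x y)) xs f)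

  *-indicator : ∀ c b → c *ᴷ (if b then 1# else 0#) ≈ (if b then c else 0#)
  *-indicator c true  = K.*-identityʳ c
  *-indicator c false = K.zeroʳ c

  if-cong : ∀ b {x y} → x ≈ y → (if b then x else 0#) ≈ (if b then y else 0#)
  if-cong true  e = e
  if-cong false e = K.refl

  fromℕ-count : ∀ {A : Set} {P : A → Set} (P? : ∀ x → Dec (P x)) xs w →
                ΣK.fold xs (λ x → if does (P? x) then w else 0#) ≈
                fromℚ (fromℕ (Σℕ.fold xs (λ x → 𝟙 (P? x)))) *ᴷ w
  fromℕ-count P? xs w = K.sym (K.trans
    (ΣK.fold-homo ℕ._+_ 0 (λ m → fromℚ (fromℕ m) *ᴷ w)
      (K.trans (K.*-congʳ ℚ→K.0#-homo) (K.zeroˡ w))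
      (λ m n → K.trans (K.*-congʳ (K.trans (K.reflexive (cong fromℚ (fromℕ-+ m n)))
                                           (ℚ→K.+-homo (fromℕ m) (fromℕ n)))) (K.distribʳ w _ _))
      xs (λ x → 𝟙 (P? x)))
    (ΣK.fold-cong xs λ x → step (does (P? x))))
    where
    step : ∀ b → fromℚ (fromℕ (if b then 1 else 0)) *ᴷ w ≈ (if b then w else 0#)
    step true  = K.trans (K.*-congʳ ℚ→K.1#-homo) (K.*-identityˡ w)
    step false = K.trans (K.*-congʳ ℚ→K.0#-homo) (K.zeroˡ w)

  pick-partition : ∀ {d r k} ρ (f : MultisetPartition d r k → K.Carrier) → (∀ {π} → ρ ≈ᴾ π → f π ≈ f ρ) →
                   ΣK.fold (partitions d r k) (λ π → if does (ρ ≟ᴾ π) then f π else 0#) ≈ f ρ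
  pick-partition {d} {r} {k} ρ f f-cong = ΣK.fold-pick
    (partitionDecSetoid d r k) {y = ρ} {xs = partitions d r k} f
    (partitions-unique d r k) (partitions-complete d r k ρ) f-cong

  -- Equivariant operators and their matrix entries

  module _ {n k r : ℕ} where

    private
      module P = LeftModule (O.𝒫 n k r)
      module MPM = LeftModule (O.MP-module r k)
      Mono = Monomial n k r
      mons : List Mono
      mons = monomials

    linear : ∀ (f : P.Carrierᴹ → P.Carrierᴹ) → (∀ {p q} → p P.≈ᴹ q → f p P.≈ᴹ f q) →
             (∀ p q → f (p P.+ᴹ q) P.≈ᴹ f p P.+ᴹ f q) → f P.0ᴹ P.≈ᴹ P.0ᴹ →
             (∀ p → f (P.-ᴹ p) P.≈ᴹ P.-ᴹ f p) → (∀ c p → f (c P.*ₗ p) P.≈ᴹ c P.*ₗ f p) →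
             IsLeftModuleHomomorphism P.rawLeftModule P.rawLeftModule f
    linear f c a z i s = record
      { +ᴹ-isGroupHomomorphism = record
        { isMonoidHomomorphism = record
          { isMagmaHomomorphism = record { isRelHomomorphism = record { cong = c } ; homo = a }
          ; ε-homo = z
          }
        ; ⁻¹-homo = i
        }
      ; *ₗ-homo = s
      }

    operator : MPM.Carrierᴹ → P.Carrierᴹ → P.Carrierᴹ
    operator u p = record
      { to   = λ e → ΣK.fold mons (λ m → u at shape (e ∷ m ∷ []) *ᴷ p at m)
      ; cong = λ { refl → K.refl }
      }

    operator-equivariant : ∀ u σ p → operator u (O._▷_ n k r σ p) P.≈ᴹ O._▷_ n k r σ (operator u p)
    operator-equivariant u σ p e = begin
      ΣK.fold mons (λ m → u at shape (e ∷ m ∷ []) *ᴷ p at (flip σ · m))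
        ≈⟨ ΣK.fold-cong mons (λ m → K.*-congʳ
             (Func.cong u (↭-sym (shape-permute (flip σ) (e ∷ m ∷ []))))) ⟩
      ΣK.fold mons (λ m → u at shape (flip σ · e ∷ flip σ · m ∷ []) *ᴷ p at (flip σ · m))
        ≈⟨ ΣK.fold-reindex _≟ᴹ_ monomials-unique ∈-monomials (flip σ ·_) (σ ·_)
             (·-inverse (flip σ) σ λ i → Perm.inverseʳ σ)
             (·-inverse σ (flip σ) λ i → Perm.inverseˡ σ)
             (λ m → u at shape (flip σ · e ∷ m ∷ []) *ᴷ p at m) ⟩
      ΣK.fold mons (λ m → u at shape (flip σ · e ∷ m ∷ []) *ᴷ p at m) ∎

    endomorphism : MPM.Carrierᴹ → O.Endomorphism n k r
    endomorphism u = record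
      { apply       = operator u
      ; isLinear    = linear (operator u)
          (λ p≈q e → ΣK.fold-cong mons λ m → K.*-congˡ (p≈q m))
          (λ p q e → K.trans (ΣK.fold-cong mons λ m → K.distribˡ _ _ _) (ΣK.fold-∙ mons _ _))
          (λ e → K.trans (ΣK.fold-cong mons λ m → K.zeroʳ _) (ΣK.fold-ε mons))
          (λ p e → K.trans (ΣK.fold-cong mons λ m → K.sym (-‿distribʳ-* _ _)) (neg-fold mons _))
          (λ c p e → K.trans (ΣK.fold-cong mons λ m → x∙yz≈y∙xz _ c _) (K.sym (*-fold c mons _)))
      ; equivariant = operator-equivariant u
      }

    -- The monomial m itself, regarded as a polynomial.
    δ : Mono → P.Carrierᴹ
    δ m = record { to = λ m′ → if does (m ≟ᴹ m′) then 1# else 0# ; cong = λ { refl → K.refl } }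

    fold-δ : ∀ (f : Mono → K.Carrier) m → ΣK.fold mons (λ m′ → f m′ *ᴷ δ m at m′) ≈ f m
    fold-δ f m = K.trans (ΣK.fold-cong mons λ m′ → *-indicator (f m′) (does (m ≟ᴹ m′)))
      (ΣK.fold-pick-≡ _≟ᴹ_ f monomials-unique (∈-monomials m))

    module _ (F : O.Endomorphism n k r) where
      private
        module F = O.Endomorphism F
        module Lin = IsLeftModuleHomomorphism F.isLinear

      entry : Vec Mono 2 → K.Carrier
      entry ms = F.apply (δ (lookup ms 1F)) at lookup ms 0F

      expansion : ∀ p e → F.apply p at e ≈ ΣK.fold mons (λ m → p at m *ᴷ entry (e ∷ m ∷ []))
      expansion p e = begin
        F.apply p at e
          ≈⟨ Lin.⟦⟧-cong p≈∑ e ⟩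
        F.apply (foldr P._+ᴹ_ P.0ᴹ (map (λ m → p at m P.*ₗ δ m) mons)) at e
          ≈⟨ ΣK.fold-homo P._+ᴹ_ P.0ᴹ (λ q → F.apply q at e) (Lin.0ᴹ-homo e) (λ q q′ → Lin.+ᴹ-homo q q′ e)
               mons (λ m → p at m P.*ₗ δ m) ⟩
        ΣK.fold mons (λ m → F.apply (p at m P.*ₗ δ m) at e)
          ≈⟨ ΣK.fold-cong mons (λ m → Lin.*ₗ-homo (p at m) (δ m) e) ⟩
        ΣK.fold mons (λ m → p at m *ᴷ entry (e ∷ m ∷ [])) ∎
        where
        δ-sym : ∀ m m′ → δ m at m′ ≡ δ m′ at m
        δ-sym m m′ = cong (λ b → if b then 1# else 0#) (does-≡ (m ≟ᴹ m′) (m′ ≟ᴹ m) ≡.sym ≡.sym)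
        p≈∑ : p P.≈ᴹ foldr P._+ᴹ_ P.0ᴹ (map (λ m → p at m P.*ₗ δ m) mons)
        p≈∑ m = K.sym (begin
          foldr P._+ᴹ_ P.0ᴹ (map (λ m → p at m P.*ₗ δ m) mons) at m
            ≈⟨ ΣK.fold-homo P._+ᴹ_ P.0ᴹ (λ q → q at m) K.refl (λ _ _ → K.refl) mons (λ m → p at m P.*ₗ δ m) ⟩
          ΣK.fold mons (λ m′ → p at m′ *ᴷ δ m′ at m)
            ≈⟨ ΣK.fold-cong mons (λ m′ → K.*-congˡ (K.reflexive (δ-sym m′ m))) ⟩
          ΣK.fold mons (λ m′ → p at m′ *ᴷ δ m at m′)
            ≈⟨ fold-δ (p at_) m ⟩
          p at m ∎)

      -- `δ (σ · m)` is `σ ▷ δ m`, so equivariance moves σ past F, where taking the coefficient at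
      -- `σ · e` undoes it.
      entry-permute : ∀ σ e m → entry (σ · e ∷ σ · m ∷ []) ≈ entry (e ∷ m ∷ [])
      entry-permute σ e m = begin
        F.apply (δ (σ · m)) at (σ · e)
          ≈⟨ Lin.⟦⟧-cong (λ m′ → K.reflexive (cong (λ b → if b then 1# else 0#)
               (does-≡ (σ · m ≟ᴹ m′) (m ≟ᴹ flip σ · m′)
               (λ { refl → ≡.sym (σ⁻¹σ m) }) (λ { refl → σσ⁻¹ m′ })))) (σ · e) ⟩
        F.apply (O._▷_ n k r σ (δ m)) at (σ · e)
          ≈⟨ F.equivariant σ (δ m) (σ · e) ⟩
        F.apply (δ m) at (flip σ · σ · e)
          ≈⟨ Func.cong (F.apply (δ m)) (σ⁻¹σ e) ⟩
        F.apply (δ m) at e ∎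
        where
        σ⁻¹σ : ∀ m → flip σ · σ · m ≡ m
        σ⁻¹σ = ·-inverse σ (flip σ) λ i → Perm.inverseˡ σ
        σσ⁻¹ : ∀ m → σ · flip σ · m ≡ m
        σσ⁻¹ = ·-inverse (flip σ) σ λ i → Perm.inverseʳ σ

      entry-cong : ∀ ms ms′ → shape ms ≈ᴾ shape ms′ → entry ms ≈ entry ms′
      entry-cong (e ∷ m ∷ []) (e′ ∷ m′ ∷ []) p
        with σ , eq ← shape-≈⇒permutation (e ∷ m ∷ []) (e′ ∷ m′ ∷ []) p
        with refl ← eq 0F | refl ← eq 1F = K.sym (entry-permute σ e m)

    -- Compatibility with the products

    module _ (u v : MPM.Carrierᴹ) where

      private
        Ps = partitions 2 r k
        Ns = partitions 3 r k
        ab : MultisetPartition 3 r k → ℚ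
        ab ν = a⟨ ν ⟩ ℚ.* b⟨ ν ⟩ (fromℕ n)
        w : MultisetPartition 3 r k → K.Carrier
        w ν = u at (ν ∣₀₁) *ᴷ v at (ν ∣₁₂)

        product-coefficient : ∀ π γ ρ → O.X-product r k n π γ at ρ ≈
          ΣK.fold Ns (λ ν → if does (ν ∣₀₁ ≟ᴾ π) ∧ does (ν ∣₁₂ ≟ᴾ γ)
                            then (if does (ν ∣₀₂ ≟ᴾ ρ) then fromℚ (ab ν) else 0#) else 0#)
        product-coefficient π γ ρ = begin
          O.X-product r k n π γ at ρ
            ≈⟨ ΣK.fold-homo MPM._+ᴹ_ MPM.0ᴹ (_at ρ) K.refl (λ _ _ → K.refl)
                 (filter select? Ns) summand ⟩
          ΣK.fold (filter select? Ns) (λ ν → fromℚ (ab ν) *ᴷ (if does (ν ∣₀₂ ≟ᴾ ρ) then 1# else 0#))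
            ≈⟨ ΣK.fold-filter select? Ns ((_at ρ) ∘ summand) ⟩
          ΣK.fold Ns (λ ν → if does (select? ν)
                            then fromℚ (ab ν) *ᴷ (if does (ν ∣₀₂ ≟ᴾ ρ) then 1# else 0#) else 0#)
            ≈⟨ ΣK.fold-cong Ns (λ ν → if-cong (does (select? ν))
                 (*-indicator (fromℚ (ab ν)) (does (ν ∣₀₂ ≟ᴾ ρ)))) ⟩
          ΣK.fold Ns (λ ν → if does (select? ν)
                            then (if does (ν ∣₀₂ ≟ᴾ ρ) then fromℚ (ab ν) else 0#) else 0#) ∎
          where
          select? : (ν : MultisetPartition 3 r k) → Dec ((ν ∣₀₁ ≈ᴾ π) × (ν ∣₁₂ ≈ᴾ γ))
          select? ν = (ν ∣₀₁ ≟ᴾ π) ×-dec (ν ∣₁₂ ≟ᴾ γ)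
          summand : MultisetPartition 3 r k → MPM.Carrierᴹ
          summand ν = fromℚ (ab ν) MPM.*ₗ O.X r k (ν ∣₀₂)

      -- Each ν contributes to exactly one pair of classes (π, γ), namely its own restrictions, so
      -- the sums over π and γ collapse and a single sum over ν remains.
      MP-coefficient : ∀ ρ → O.Algebra._*_ (O.MP r k n) u v at ρ ≈
                       ΣK.fold Ns (λ ν → w ν *ᴷ (if does (ν ∣₀₂ ≟ᴾ ρ) then fromℚ (ab ν) else 0#))
      MP-coefficient ρ = begin
        O.Algebra._*_ (O.MP r k n) u v at ρ
          ≈⟨ at-∑ (λ π → O.∑ r k Ps λ γ → (u at π *ᴷ v at γ) MPM.*ₗ O.X-product r k n π γ) ⟩
        ΣK.fold Ps (λ π → (O.∑ r k Ps λ γ → (u at π *ᴷ v at γ) MPM.*ₗ O.X-product r k n π γ) at ρ)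
          ≈⟨ ΣK.fold-cong Ps (λ π → at-∑ (λ γ → (u at π *ᴷ v at γ) MPM.*ₗ O.X-product r k n π γ)) ⟩
        ΣK.fold Ps (λ π → ΣK.fold Ps (λ γ → (u at π *ᴷ v at γ) *ᴷ O.X-product r k n π γ at ρ))
          ≈⟨ ΣK.fold-cong Ps (λ π → ΣK.fold-cong Ps λ γ →
               K.trans (K.*-congˡ (product-coefficient π γ ρ)) (*-fold _ Ns _)) ⟩
        ΣK.fold Ps (λ π → ΣK.fold Ps (λ γ → ΣK.fold Ns (λ ν → term ν π γ)))
          ≈⟨ ΣK.fold-cong Ps (λ π → ΣK.fold-comm Ps Ns λ γ ν → term ν π γ) ⟩
        ΣK.fold Ps (λ π → ΣK.fold Ns (λ ν → ΣK.fold Ps (λ γ → term ν π γ)))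
          ≈⟨ ΣK.fold-comm Ps Ns (λ π ν → ΣK.fold Ps (λ γ → term ν π γ)) ⟩
        ΣK.fold Ns (λ ν → ΣK.fold Ps (λ π → ΣK.fold Ps (λ γ → term ν π γ)))
          ≈⟨ ΣK.fold-cong Ns collapse ⟩
        ΣK.fold Ns (λ ν → w ν *ᴷ c ν) ∎
        where
        c : MultisetPartition 3 r k → K.Carrier
        c ν = if does (ν ∣₀₂ ≟ᴾ ρ) then fromℚ (ab ν) else 0#
        term : MultisetPartition 3 r k → MultisetPartition 2 r k → MultisetPartition 2 r k → K.Carrier
        term ν π γ = (u at π *ᴷ v at γ) *ᴷ (if does (ν ∣₀₁ ≟ᴾ π) ∧ does (ν ∣₁₂ ≟ᴾ γ) then c ν else 0#)
        at-∑ : (f : MultisetPartition 2 r k → MPM.Carrierᴹ) →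
               O.∑ r k Ps f at ρ ≈ ΣK.fold Ps (λ π → f π at ρ)
        at-∑ f = ΣK.fold-homo MPM._+ᴹ_ MPM.0ᴹ (_at ρ) K.refl (λ _ _ → K.refl) Ps f
        nest : ∀ b b′ x y → x *ᴷ (if b ∧ b′ then y else 0#) ≈ (if b then (if b′ then x *ᴷ y else 0#) else 0#)
        nest true  true  x y = K.refl
        nest true  false x y = K.zeroʳ x
        nest false _     x y = K.zeroʳ x
        fold-if : ∀ b (f : MultisetPartition 2 r k → K.Carrier) →
                  ΣK.fold Ps (λ γ → if b then f γ else 0#) ≈ (if b then ΣK.fold Ps f else 0#)
        fold-if true  f = K.refl
        fold-if false f = ΣK.fold-ε Ps
        collapse : ∀ ν → ΣK.fold Ps (λ π → ΣK.fold Ps (λ γ → term ν π γ)) ≈ w ν *ᴷ c ν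
        collapse ν = begin
          ΣK.fold Ps (λ π → ΣK.fold Ps (λ γ → term ν π γ))
            ≈⟨ ΣK.fold-cong Ps (λ π → ΣK.fold-cong Ps λ γ →
                 nest (does (ν ∣₀₁ ≟ᴾ π)) (does (ν ∣₁₂ ≟ᴾ γ)) (u at π *ᴷ v at γ) (c ν)) ⟩
          ΣK.fold Ps (λ π → ΣK.fold Ps (λ γ →
            if does (ν ∣₀₁ ≟ᴾ π) then (if does (ν ∣₁₂ ≟ᴾ γ) then (u at π *ᴷ v at γ) *ᴷ c ν else 0#) else 0#))
            ≈⟨ ΣK.fold-cong Ps (λ π → K.trans (fold-if (does (ν ∣₀₁ ≟ᴾ π)) _) (if-cong (does (ν ∣₀₁ ≟ᴾ π))
                 (pick-partition (ν ∣₁₂) (λ γ → (u at π *ᴷ v at γ) *ᴷ c ν)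
                   λ p → K.*-congʳ (K.*-congˡ (Func.cong v (↭-sym p)))))) ⟩
          ΣK.fold Ps (λ π → if does (ν ∣₀₁ ≟ᴾ π) then (u at π *ᴷ v at (ν ∣₁₂)) *ᴷ c ν else 0#)
            ≈⟨ pick-partition (ν ∣₀₁) (λ π → (u at π *ᴷ v at (ν ∣₁₂)) *ᴷ c ν)
                 (λ p → K.*-congʳ (K.*-congʳ (Func.cong u (↭-sym p)))) ⟩
          w ν *ᴷ c ν ∎

      ∑-middle : ∀ e g → ΣK.fold mons (λ m → u at shape (e ∷ m ∷ []) *ᴷ v at shape (m ∷ g ∷ [])) ≈
                 O.Algebra._*_ (O.MP r k n) u v at shape (e ∷ g ∷ [])
      ∑-middle e g = begin
        ΣK.fold mons (λ m → u at shape (e ∷ m ∷ []) *ᴷ v at shape (m ∷ g ∷ []))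
          ≈⟨ ΣK.fold-cong mons (λ m → K.*-cong
               (Func.cong u (↭-reflexive (≡.sym (restrict-shape 2F (e ∷ m ∷ g ∷ [])))))
               (Func.cong v (↭-reflexive (≡.sym (restrict-shape 0F (e ∷ m ∷ g ∷ [])))))) ⟩
        ΣK.fold mons (λ m → w (τ m))
          -- The summand depends only on the class of `τ m`, so it can be spread over the list of
          -- representatives ν and the monomials grouped by shape.
          ≈⟨ ΣK.fold-cong mons (λ m → K.sym (pick-partition (τ m) w λ {ν} p → K.*-cong
               (Func.cong u (restrict-cong 2F {ν} {τ m} (↭-sym p)))
               (Func.cong v (restrict-cong 0F {ν} {τ m} (↭-sym p))))) ⟩
        ΣK.fold mons (λ m → ΣK.fold Ns (λ ν → if does (τ m ≟ᴾ ν) then w ν else 0#))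
          ≈⟨ ΣK.fold-comm mons Ns _ ⟩
        ΣK.fold Ns (λ ν → ΣK.fold mons (λ m → if does (τ m ≟ᴾ ν) then w ν else 0#))
          ≈⟨ ΣK.fold-cong Ns (λ ν → fromℕ-count (λ m → τ m ≟ᴾ ν) mons (w ν)) ⟩
        ΣK.fold Ns (λ ν → fromℚ (fromℕ (Σℕ.fold mons (λ m → 𝟙 (τ m ≟ᴾ ν)))) *ᴷ w ν)
          ≈⟨ ΣK.fold-cong Ns (λ ν → K.trans (K.*-congʳ (K.reflexive (cong fromℚ (count-shapes ν e g))))
               (coefficient (ab ν) (does (ν ∣₀₂ ≟ᴾ shape (e ∷ g ∷ []))) (w ν))) ⟩
        ΣK.fold Ns (λ ν → w ν *ᴷ (if does (ν ∣₀₂ ≟ᴾ shape (e ∷ g ∷ [])) then fromℚ (ab ν) else 0#))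
          ≈⟨ MP-coefficient (shape (e ∷ g ∷ [])) ⟨
        O.Algebra._*_ (O.MP r k n) u v at shape (e ∷ g ∷ []) ∎
        where
        τ : Mono → MultisetPartition 3 r k
        τ m = shape (e ∷ m ∷ g ∷ [])
        coefficient : ∀ q b x → fromℚ (q ℚ.* fromℕ (if b then 1 else 0)) *ᴷ x ≈ x *ᴷ (if b then fromℚ q else 0#)
        coefficient q true  x = K.trans (K.*-congʳ (K.reflexive (cong fromℚ (ℚₚ.*-identityʳ q)))) (K.*-comm _ x)
        coefficient q false x = K.trans (K.*-congʳ (K.trans
          (K.reflexive (cong fromℚ (ℚₚ.*-zeroʳ q))) ℚ→K.0#-homo)) (K.*-comm _ x)

      endomorphism-* : ∀ p → operator (O.Algebra._*_ (O.MP r k n) u v) p P.≈ᴹ operator u (operator v p)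
      endomorphism-* p e = begin
        ΣK.fold mons (λ g → O.Algebra._*_ (O.MP r k n) u v at shape (e ∷ g ∷ []) *ᴷ p at g)
          ≈⟨ ΣK.fold-cong mons (λ g → K.trans (K.*-congʳ (K.sym (∑-middle e g)))
               (K.trans (K.*-comm _ _) (*-fold (p at g) mons _))) ⟩
        ΣK.fold mons (λ g → ΣK.fold mons (λ m → p at g *ᴷ (u at shape (e ∷ m ∷ []) *ᴷ v at shape (m ∷ g ∷ []))))
          ≈⟨ ΣK.fold-comm mons mons _ ⟩
        ΣK.fold mons (λ m → ΣK.fold mons (λ g → p at g *ᴷ (u at shape (e ∷ m ∷ []) *ᴷ v at shape (m ∷ g ∷ []))))
          ≈⟨ ΣK.fold-cong mons (λ m → ΣK.fold-cong mons λ g →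
               K.trans (K.*-comm (p at g) _)
                 (K.*-assoc (u at shape (e ∷ m ∷ [])) (v at shape (m ∷ g ∷ [])) (p at g))) ⟩
        ΣK.fold mons (λ m → ΣK.fold mons (λ g → u at shape (e ∷ m ∷ []) *ᴷ (v at shape (m ∷ g ∷ []) *ᴷ p at g)))
          ≈⟨ ΣK.fold-cong mons (λ m → *-fold (u at shape (e ∷ m ∷ [])) mons
               (λ g → v at shape (m ∷ g ∷ []) *ᴷ p at g)) ⟨
        ΣK.fold mons (λ m → u at shape (e ∷ m ∷ []) *ᴷ ΣK.fold mons (λ g → v at shape (m ∷ g ∷ []) *ᴷ p at g)) ∎

  -- Linearity and bijectivity

  MP≅𝒜 : (n k r : ℕ) → n ≥ 2 * r → O._≅_ (O.MP r k n) (O.𝒜 n k r)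
  MP≅𝒜 n k r n≥2r = record
    { to       = endomorphism
    ; isLinear = record
      { isLeftModuleMonomorphism = record
        { isLeftModuleHomomorphism = record
          { +ᴹ-isGroupHomomorphism = record
            { isMonoidHomomorphism = record
              { isMagmaHomomorphism = record
                { isRelHomomorphism = record
                  { cong = λ u≈v p e → ΣK.fold-cong mons λ m → K.*-congʳ (u≈v (shape (e ∷ m ∷ []))) }
                ; homo = λ u v p e → K.trans (ΣK.fold-cong mons λ m → K.distribʳ _ _ _) (ΣK.fold-∙ mons _ _)
                }
              ; ε-homo = λ p e → K.trans (ΣK.fold-cong mons λ m → K.zeroˡ _) (ΣK.fold-ε mons)
              }
            ; ⁻¹-homo = λ u p e → K.trans (ΣK.fold-cong mons λ m → K.sym (-‿distribˡ-* _ _))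
                                    (neg-fold mons _)
            }
          ; *ₗ-homo = λ c u p e → K.trans (ΣK.fold-cong mons λ m → K.*-assoc c _ _) (K.sym (*-fold c mons _))
          }
        ; injective = λ {u} {v} → injective u v
        }
      ; surjective = surjective
      }
    ; *-homo   = endomorphism-*
    }
    where
    open RingProperties K.ring using (-‿distribˡ-*)
    module MPM = LeftModule (O.MP-module r k)
    module P = LeftModule (O.𝒫 n k r)
    mons : List (Monomial n k r)
    mons = monomials
    realise : MultisetPartition 2 r k → Vec (Monomial n k r) 2
    realise π = proj₁ (shape-surjective n≥2r π)
    shape-realise : ∀ π → shape (realise π) ≈ᴾ π
    shape-realise π = ↭-reflexive (proj₂ (shape-surjective n≥2r π))

    -- Applying the operator to a monomial isolates a single matrix entry, and every partition is
    -- the shape of some pair.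
    injective : ∀ u v → (∀ p → operator u p P.≈ᴹ operator v p) → u MPM.≈ᴹ v
    injective u v eq π = begin
      u at π                     ≈⟨ Func.cong u (shape-realise π) ⟨
      u at shape (realise π)     ≈⟨ agree (realise π) ⟩
      v at shape (realise π)     ≈⟨ Func.cong v (shape-realise π) ⟩
      v at π                     ∎
      where
      agree : ∀ ms → u at shape ms ≈ v at shape ms
      agree (e ∷ m ∷ []) = begin
        u at shape (e ∷ m ∷ [])   ≈⟨ fold-δ (λ m → u at shape (e ∷ m ∷ [])) m ⟨
        operator u (δ m) at e     ≈⟨ eq (δ m) e ⟩
        operator v (δ m) at e     ≈⟨ fold-δ (λ m → v at shape (e ∷ m ∷ [])) m ⟩
        v at shape (e ∷ m ∷ [])   ∎

    surjective : ∀ F → ∃ λ u → ∀ {z} → z MPM.≈ᴹ u → ∀ p → operator z p P.≈ᴹ O.Endomorphism.apply F p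
    surjective F = preimage , λ {z} z≈ p e → begin
      operator z p at e
        ≈⟨ ΣK.fold-cong mons (λ m → K.trans (K.*-congʳ (K.trans (z≈ (shape (e ∷ m ∷ [])))
             (entry-cong F (realise (shape (e ∷ m ∷ []))) (e ∷ m ∷ []) (shape-realise _)))) (K.*-comm _ _)) ⟩
      ΣK.fold mons (λ m → p at m *ᴷ entry F (e ∷ m ∷ []))
        ≈⟨ expansion F p e ⟨
      O.Endomorphism.apply F p at e ∎
      where
      preimage : MPM.Carrierᴹ
      preimage = record
        -- The choice of the pair realising π is immaterial: `entry-cong` makes the entries of F
        -- agree on all pairs of the same shape.
        { to   = λ π → entry F (realise π)
        ; cong = λ {π} {π′} π≈π′ → entry-cong F (realise π) (realise π′)
            (↭-trans (shape-realise π) (↭-trans π≈π′ (↭-sym (shape-realise π′))))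
        }

ℚ→ℂ-isSemiringHomomorphism :
  IsSemiringHomomorphism ℚ.+-*-rawSemiring
    (Semiring.rawSemiring (CommutativeRing.semiring ℂ-commutativeRing)) ℚ→ℂ
ℚ→ℂ-isSemiringHomomorphism = record
  { isNearSemiringHomomorphism = record
    { +-isMonoidHomomorphism = record
      { isMagmaHomomorphism = record
        { isRelHomomorphism = record { cong = λ { refl → C.refl } }
        ; homo = λ p q → pointwise (λ _ → refl) ,≈ pointwise (λ _ → refl)
        }
      ; ε-homo = C.refl
      }
    ; *-homo = λ p q →
        pointwise (λ _ → solve 2 (λ p q → p :* q := p :* q :+ :- (con 0ℚ :* con 0ℚ)) refl p q) ,≈
        pointwise (λ _ → solve 2 (λ p q → con 0ℚ := p :* con 0ℚ :+ con 0ℚ :* q) refl p q)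
    }
  ; 1#-homo = C.refl
  }
  where
  module C = CommutativeRing ℂ-commutativeRing
  open ℚ-Solver.+-*-Solver using (solve; con; _:=_; _:+_; _:*_; :-_)

theorem4p7 : (n k r : ℕ) .{{_ : NonZero n}} .{{_ : NonZero k}} .{{_ : NonZero r}} →
    n ≥ 2 * r → MP r k n ≅ 𝒜 n k r
theorem4p7 n k r = OverRing.MP≅𝒜 ℂ-commutativeRing ℚ→ℂ ℚ→ℂ-isSemiringHomomorphism n k r
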